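{- Let $C=(c_{ij})$ be an $n\times n$ nonnegative matrix. Let $m$ be the sum of the entries of $C$, and let $d$ (resp. $f$) be any number which is larger than or equal to the largest diagonal element (resp. the largest off-diagonal element) of $C$. Then $$\rho(C)\le \frac{d-f+\sqrt{(d-f)^2+4mf}}{2}.$$ Moreover, if $mf>0$, then equality holds if and only if $m=k(k-1)f+kd$ and $$PCP^T=\begin{pmatrix} fJ_k+(d-f)I_k & 0\\ 0 & O_{n-k}\end{pmatrix}$$ for some $n\times n$ permutation matrix $P$ and some nonnegative integer $k$.
   Context: All matrices are real. $\rho(C)$ denotes the spectral radius of $C$, i.e. the maximum modulus of its (complex) eigenvalues. $J_k$, $I_k$, $O_k$ denote the $k\times k$ all-one, identity, and zero matrices. -}

module Defs where

open import Algebra.Bundles using (CommutativeRing; RawRing)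
import Algebra.Definitions.RawMonoid as RawMonoidDefs
import Algebra.Properties.Ring as RingProperties
import Algebra.Solver.Ring.NaturalCoefficients.Default as NatSolver
open import Data.Bool.Base using (if_then_else_)
open import Data.Fin.Base using (Fin; cast)
open import Data.Fin.Properties using (_≟_)
open import Data.Fin.Permutation using (Permutation′; _⟨$⟩ʳ_)
open import Data.Nat.Base as ℕ using (ℕ)
open import Data.Product.Base using (Σ-syntax; ∃; _×_; _,_; proj₁; proj₂)
open import Data.Sum.Base using (_⊎_; inj₁; inj₂)
open import Data.Vec.Functional using (Vector; zipWith; _++_)
open import Level using (0ℓ)
open import Relation.Binary.Core using (Rel)
open import Relation.Binary.Structures using (IsDecTotalOrder)
import Relation.Binary.Construct.NonStrictToStrict as Strict
open import Relation.Binary.PropositionalEquality.Core as ≡ using (_≡_)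
open import Relation.Nullary using (¬_; does; yes; no; contradiction)
open import Relation.Unary using (Pred)

-- The real numbers, given axiomatically: classically these axioms have exactly
-- one model up to isomorphism.  The order is decidable, as in classical
-- analysis.  The value of 0# ⁻¹ is unspecified.
record CompleteOrderedField : Set₁ where
  field
    commutativeRing : CommutativeRing 0ℓ 0ℓ

  open CommutativeRing commutativeRing public

  infix 4 _≤_
  infix 9 _⁻¹

  field
    1≉0             : 1# ≉ 0#
    _⁻¹             : Carrier → Carrier
    ⁻¹-cong         : ∀ {x y} → x ≈ y → x ⁻¹ ≈ y ⁻¹
    ⁻¹-inverseʳ     : ∀ {x} → x ≉ 0# → x * x ⁻¹ ≈ 1#
    _≤_             : Rel Carrier 0ℓ
    isDecTotalOrder : IsDecTotalOrder _≈_ _≤_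
    +-monoˡ-≤       : ∀ z {x y} → x ≤ y → x + z ≤ y + z
    *-nonneg        : ∀ {x y} → 0# ≤ x → 0# ≤ y → 0# ≤ x * y

  IsUpperBound : Pred Carrier 0ℓ → Pred Carrier 0ℓ
  IsUpperBound S b = ∀ {x} → S x → x ≤ b

  IsLeastUpperBound : Pred Carrier 0ℓ → Pred Carrier 0ℓ
  IsLeastUpperBound S s = IsUpperBound S s × (∀ {b} → IsUpperBound S b → s ≤ b)

  field
    complete : ∀ (S : Pred Carrier 0ℓ) → ∃ S → ∃ (IsUpperBound S) →
               ∃ (IsLeastUpperBound S)

  open Strict _≈_ _≤_ public using (_<_)

  infixl 7 _/_

  _/_ : Carrier → Carrier → Carrier
  x / y = x * y ⁻¹

  fromℕ : ℕ → Carrier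
  fromℕ k = k ×# 1#
    where open RawMonoidDefs +-rawMonoid renaming (_×_ to _×#_)

module SquareRoot (ℝ : CompleteOrderedField) where
  open CompleteOrderedField ℝ
  open RingProperties ring using (-‿distribʳ-*)
  open NatSolver commutativeSemiring using (solve; _:=_; _:+_; _:*_; con)
  open IsDecTotalOrder isDecTotalOrder
    using (total; antisym; ≤-respˡ-≈; ≤-respʳ-≈)
    renaming (refl to ≤-refl; reflexive to ≤-reflexive; trans to ≤-trans; _≟_ to _≈?_)

  private
    ≤-resp : ∀ {x x′ y y′} → x ≈ x′ → y ≈ y′ → x ≤ y → x′ ≤ y′
    ≤-resp p q r = ≤-respˡ-≈ p (≤-respʳ-≈ q r)

    x≤x+p : ∀ x {p} → 0# ≤ p → x ≤ x + p
    x≤x+p x {p} 0≤p = ≤-resp (+-identityˡ x) (+-comm p x) (+-monoˡ-≤ x 0≤p)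

    +-nonneg : ∀ {x y} → 0# ≤ x → 0# ≤ y → 0# ≤ x + y
    +-nonneg {x} 0≤x 0≤y = ≤-trans 0≤x (x≤x+p x 0≤y)

    ≤⇒+ : ∀ {x y} → x ≤ y → Σ[ p ∈ Carrier ] 0# ≤ p × y ≈ x + p
    ≤⇒+ {x} {y} x≤y = y - x , ≤-respˡ-≈ (-‿inverseʳ x) (+-monoˡ-≤ (- x) x≤y) , sym (
      trans (+-congˡ (+-comm y (- x))) (trans (sym (+-assoc x (- x) y))
      (trans (+-congʳ (-‿inverseʳ x)) (+-identityˡ y))))

    *-monoʳ : ∀ {x y z} → 0# ≤ z → x ≤ y → z * x ≤ z * y
    *-monoʳ {x} {y} {z} 0≤z x≤y with ≤⇒+ x≤y
    ... | p , 0≤p , y≈x+p =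
      ≤-respʳ-≈ (sym (trans (*-congˡ y≈x+p) (distribˡ z x p)))
        (x≤x+p (z * x) (*-nonneg 0≤z 0≤p))

    ≤0⇒-nonneg : ∀ {x} → x ≤ 0# → 0# ≤ - x
    ≤0⇒-nonneg {x} x≤0 = ≤-resp (-‿inverseʳ x) (+-identityˡ (- x)) (+-monoˡ-≤ (- x) x≤0)

    -nonneg⇒≤0 : ∀ {x} → 0# ≤ - x → x ≤ 0#
    -nonneg⇒≤0 {x} 0≤-x = ≤-resp (+-identityˡ x) (-‿inverseˡ x) (+-monoˡ-≤ x 0≤-x)

    0≤x² : ∀ x → 0# ≤ x * x
    0≤x² x with total 0# x
    ... | inj₁ 0≤x = *-nonneg 0≤x 0≤x
    ... | inj₂ x≤0 = ≤-respʳ-≈ (square-neg x) (*-nonneg (≤0⇒-nonneg x≤0) (≤0⇒-nonneg x≤0))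
      where open RingProperties ring using (-‿distribˡ-*; -‿involutive)
            square-neg : ∀ x → - x * - x ≈ x * x
            square-neg x = trans (sym (-‿distribˡ-* x (- x)))
              (trans (-‿cong (sym (-‿distribʳ-* x x))) (-‿involutive (x * x)))

    0≤1 : 0# ≤ 1#
    0≤1 = ≤-respʳ-≈ (*-identityˡ 1#) (0≤x² 1#)

    1≤⇒≉0 : ∀ {u} → 1# ≤ u → u ≉ 0#
    1≤⇒≉0 1≤u u≈0 = 1≉0 (antisym (≤-respʳ-≈ u≈0 1≤u) 0≤1)

    1≤⇒⁻¹-nonneg : ∀ {u} → 1# ≤ u → 0# ≤ u ⁻¹
    1≤⇒⁻¹-nonneg {u} 1≤u with total 0# (u ⁻¹)
    ... | inj₁ 0≤w = 0≤w
    ... | inj₂ w≤0 = contradiction (antisym 1≤0 0≤1) 1≉0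
      where
      1≤0 : 1# ≤ 0#
      1≤0 = -nonneg⇒≤0 (≤-respʳ-≈
        (trans (sym (-‿distribʳ-* u (u ⁻¹))) (-‿cong (⁻¹-inverseʳ (1≤⇒≉0 1≤u))))
        (*-nonneg (≤-trans 0≤1 1≤u) (≤0⇒-nonneg w≤0)))

    1≤⇒≤² : ∀ {y} → 1# ≤ y → y ≤ y * y
    1≤⇒≤² {y} 1≤y = ≤-respˡ-≈ (*-identityʳ y) (*-monoʳ (≤-trans 0≤1 1≤y) 1≤y)

    x²≈0⇒x≈0 : ∀ {x} → x * x ≈ 0# → x ≈ 0#
    x²≈0⇒x≈0 {x} x²≈0 with x ≈? 0#
    ... | yes x≈0 = x≈0
    ... | no  x≉0 = trans (sym (*-identityʳ x)) (trans (*-congˡ (sym (⁻¹-inverseʳ x≉0)))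
      (trans (sym (*-assoc x x (x ⁻¹))) (trans (*-congʳ x²≈0) (zeroˡ _))))

    ²-cancel-≤ : ∀ {y t} → 0# ≤ t → y * y ≤ t * t → y ≤ t
    ²-cancel-≤ {y} {t} 0≤t y²≤t² with total y t
    ... | inj₁ y≤t = y≤t
    ... | inj₂ t≤y with ≤⇒+ t≤y | ≤⇒+ y²≤t²
    ...   | p , 0≤p , y≈t+p | e , 0≤e , t²≈y²+e =
      ≤-reflexive (trans y≈t+p (trans (+-congˡ (x²≈0⇒x≈0 p²≈0)) (+-identityʳ t)))
      where
      r = (t * p + t * p) + e

      0≤r : 0# ≤ r
      0≤r = +-nonneg (+-nonneg (*-nonneg 0≤t 0≤p) (*-nonneg 0≤t 0≤p)) 0≤e

      t²≈t²+ : t * t + 0# ≈ t * t + (p * p + r)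
      t²≈t²+ = trans (+-identityʳ _) (trans t²≈y²+e (trans (+-congʳ (*-cong y≈t+p y≈t+p))
        (solve 3 (λ t p e → (t :+ p) :* (t :+ p) :+ e
                    := t :* t :+ (p :* p :+ ((t :* p :+ t :* p) :+ e))) refl t p e)))

      p²+r≈0 : p * p + r ≈ 0#
      p²+r≈0 = sym (RingProperties.+-cancelˡ ring (t * t) _ _ t²≈t²+)

      p²≈0 : p * p ≈ 0#
      p²≈0 = antisym (≤-respʳ-≈ p²+r≈0 (x≤x+p (p * p) 0≤r)) (0≤x² p)

    Below : Carrier → Pred Carrier 0ℓ
    Below x y = y ≤ 0# ⊎ y * y ≤ x

    Below-bound : ∀ x → IsUpperBound (Below x) (1# + x * x)
    Below-bound x {y} y∈ with total y 1#
    ... | inj₁ y≤1 = ≤-trans y≤1 (x≤x+p 1# (0≤x² x))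
    ... | inj₂ 1≤y with y∈
    ...   | inj₁ y≤0  = ≤-trans y≤0 (+-nonneg 0≤1 (0≤x² x))
    ...   | inj₂ y²≤x = ≤-trans y≤x (≤-trans (1≤⇒≤² (≤-trans 1≤y y≤x))
                          (≤-respʳ-≈ (+-comm _ _) (x≤x+p (x * x) 0≤1)))
      where y≤x = ≤-trans (1≤⇒≤² 1≤y) y²≤x

    supBelow : ∀ x → ∃ (IsLeastUpperBound (Below x))
    supBelow x = complete (Below x) (0# , inj₁ ≤-refl) (1# + x * x , Below-bound x)

  -- The supremum of { y | y ≤ 0 or y² ≤ x }: the nonnegative square root of
  -- x when 0 ≤ x (see √-square), and 0 when x < 0.
  √ : Carrier → Carrier
  √ x = proj₁ (supBelow x)

  √-nonneg : ∀ x → 0# ≤ √ x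
  √-nonneg x = proj₁ (proj₂ (supBelow x)) (inj₁ ≤-refl)

  √-square : ∀ {x} → 0# ≤ x → √ x * √ x ≈ x
  √-square {x} 0≤x = case-total (total (s * s) x)
    where
    s  = √ x
    a  = 1# + x
    q  = 1# + x + x * x
    u  = s + a
    w  = u ⁻¹
    z  = x + s * a
    t  = z * w

    isLub : IsLeastUpperBound (Below x) s
    isLub = proj₂ (supBelow x)

    0≤a : 0# ≤ a
    0≤a = +-nonneg 0≤1 0≤x

    0≤q : 0# ≤ q
    0≤q = +-nonneg 0≤a (0≤x² x)

    1≤u : 1# ≤ u
    1≤u = ≤-trans (x≤x+p 1# 0≤x) (≤-respʳ-≈ (+-comm a s) (x≤x+p a (√-nonneg x)))

    0≤u = ≤-trans 0≤1 1≤u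
    0≤w = 1≤⇒⁻¹-nonneg 1≤u

    uw≈1 : u * w ≈ 1#
    uw≈1 = ⁻¹-inverseʳ (1≤⇒≉0 1≤u)

    0≤t : 0# ≤ t
    0≤t = *-nonneg (+-nonneg 0≤x (*-nonneg (√-nonneg x) 0≤a)) 0≤w

    ut≈z : u * t ≈ z
    ut≈z = trans (solve 3 (λ u z w → u :* (z :* w) := z :* (u :* w)) refl u z w)
                 (trans (*-congˡ uw≈1) (*-identityʳ z))

    us≈ : u * s ≈ s * s + s * a
    us≈ = solve 2 (λ s a → (s :+ a) :* s := s :* s :+ s :* a) refl s a

    +-cancelʳ-≤ : ∀ {y y′} c → y + c ≤ y′ + c → y ≤ y′
    +-cancelʳ-≤ {y} {y′} c le = ≤-resp (undo y) (undo y′) (+-monoˡ-≤ (- c) le)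
      where
      undo : ∀ v → v + c - c ≈ v
      undo v = trans (+-assoc v c (- c)) (trans (+-congˡ (-‿inverseʳ c)) (+-identityʳ v))

    w²[v·u²]≈v : ∀ v → (w * w) * (v * (u * u)) ≈ v
    w²[v·u²]≈v v = trans
      (solve 3 (λ w v u → (w :* w) :* (v :* (u :* u)) := v :* ((u :* w) :* (u :* w))) refl w v u)
      (trans (*-congˡ (trans (*-cong uw≈1 uw≈1) (*-identityˡ 1#))) (*-identityʳ v))

    w²z²≈t² : (w * w) * (z * z) ≈ t * t
    w²z²≈t² = solve 2 (λ w z → (w :* w) :* (z :* z) := (z :* w) :* (z :* w)) refl w z

    case-total : s * s ≤ x ⊎ x ≤ s * s → s * s ≈ x
    case-total (inj₁ s²≤x) with ≤⇒+ s²≤x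
    ... | p , 0≤p , x≈s²+p = antisym s²≤x x≤s²
      where
      z²+pq≈xu² : z * z + p * q ≈ x * (u * u)
      z²+pq≈xu² = trans (+-congʳ (*-cong z≈ z≈)) (trans
        (+-congˡ (*-congˡ (+-cong (+-congˡ x≈s²+p) (*-cong x≈s²+p x≈s²+p))))
        (trans (solve 2 (λ s p →
            let x = s :* s :+ p; a = con 1 :+ x; z = x :+ s :* a in
            z :* z :+ p :* (con 1 :+ x :+ x :* x) := x :* ((s :+ a) :* (s :+ a)))
          refl s p) (sym (*-cong x≈s²+p (*-cong u≈ u≈)))))
        where
        z≈ : z ≈ (s * s + p) + s * (1# + (s * s + p))
        z≈ = +-cong x≈s²+p (*-congˡ (+-congˡ x≈s²+p))
        u≈ : u ≈ s + (1# + (s * s + p))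
        u≈ = +-congˡ (+-congˡ x≈s²+p)

      t²≤x : t * t ≤ x
      t²≤x = ≤-resp w²z²≈t² (w²[v·u²]≈v x) (*-monoʳ (0≤x² w)
        (≤-respʳ-≈ z²+pq≈xu² (x≤x+p (z * z) (*-nonneg 0≤p 0≤q))))

      x≤s² : x ≤ s * s
      x≤s² = +-cancelʳ-≤ (s * a)
        (≤-resp ut≈z us≈ (*-monoʳ 0≤u (proj₁ isLub (inj₂ t²≤x))))
    case-total (inj₂ x≤s²) with ≤⇒+ x≤s²
    ... | p , 0≤p , s²≈x+p = antisym s²≤x x≤s²
      where
      xu²+pq≈z² : x * (u * u) + p * q ≈ z * z
      xu²+pq≈z² = trans
        (solve 3 (λ s x p →
            let a = con 1 :+ x in
            x :* ((s :+ a) :* (s :+ a)) :+ p :* (con 1 :+ x :+ x :* x)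
              := x :* (s :* s) :+ ((x :+ x) :* s :* a :+ x :* a :* a)
                 :+ p :* (con 1 :+ x :+ x :* x))
          refl s x p)
        (trans (+-congʳ (+-congʳ (*-congˡ s²≈x+p)))
        (trans (solve 3 (λ s x p →
            let a = con 1 :+ x in
            x :* (x :+ p) :+ ((x :+ x) :* s :* a :+ x :* a :* a)
                 :+ p :* (con 1 :+ x :+ x :* x)
              := x :* x :+ (x :+ x) :* s :* a :+ (x :+ p) :* (a :* a))
          refl s x p)
        (trans (+-congˡ (*-congʳ (sym s²≈x+p)))
        (solve 2 (λ s x →
            let a = con 1 :+ x; z = x :+ s :* a in
            x :* x :+ (x :+ x) :* s :* a :+ (s :* s) :* (a :* a) := z :* z)
          refl s x))))

      x≤t² : x ≤ t * t
      x≤t² = ≤-resp (w²[v·u²]≈v x) w²z²≈t² (*-monoʳ (0≤x² w)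
        (≤-respʳ-≈ xu²+pq≈z² (x≤x+p (x * (u * u)) (*-nonneg 0≤p 0≤q))))

      t-bound : IsUpperBound (Below x) t
      t-bound (inj₁ y≤0)  = ≤-trans y≤0 0≤t
      t-bound (inj₂ y²≤x) = ²-cancel-≤ 0≤t (≤-trans y²≤x x≤t²)

      s²≤x : s * s ≤ x
      s²≤x = +-cancelʳ-≤ (s * a)
        (≤-resp us≈ ut≈z (*-monoʳ 0≤u (proj₂ isLub t-bound)))

module Matrices {c ℓ} (R : RawRing c ℓ) where
  open RawRing R
  open RawMonoidDefs +-rawMonoid using (sum)

  infix  4 _≈ᵛ_ _≈ᴹ_
  infixl 6 _+ᴹ_
  infixl 7 _*ᴹ_ _*ᵛ_ _·ᴹ_ _·ᵛ_

  Matrix : ℕ → ℕ → Set c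
  Matrix m n = Vector (Vector Carrier n) m

  _≈ᵛ_ : ∀ {n} → Vector Carrier n → Vector Carrier n → Set ℓ
  x ≈ᵛ y = ∀ i → x i ≈ y i

  _≈ᴹ_ : ∀ {m n} → Matrix m n → Matrix m n → Set ℓ
  A ≈ᴹ B = ∀ i j → A i j ≈ B i j

  0ᵛ : ∀ {n} → Vector Carrier n
  0ᵛ i = 0#

  _·ᵛ_ : ∀ {n} → Carrier → Vector Carrier n → Vector Carrier n
  (a ·ᵛ x) i = a * x i

  _*ᵛ_ : ∀ {m n} → Matrix m n → Vector Carrier n → Vector Carrier m
  (A *ᵛ x) i = sum λ j → A i j * x j

  _+ᴹ_ : ∀ {m n} → Matrix m n → Matrix m n → Matrix m n
  (A +ᴹ B) i j = A i j + B i j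

  _·ᴹ_ : ∀ {m n} → Carrier → Matrix m n → Matrix m n
  (a ·ᴹ A) i j = a * A i j

  _*ᴹ_ : ∀ {l m n} → Matrix l m → Matrix m n → Matrix l n
  (A *ᴹ B) i k = sum λ j → A i j * B j k

  entrySum : ∀ {m n} → Matrix m n → Carrier
  entrySum A = sum λ i → sum λ j → A i j

  J I : ∀ n → Matrix n n
  J n i j = 1#
  I n i j = if does (i ≟ j) then 1# else 0#

  O : ∀ m n → Matrix m n
  O m n i j = 0#

  permutationMatrix : ∀ {n} → Permutation′ n → Matrix n n
  permutationMatrix π i j = if does (π ⟨$⟩ʳ i ≟ j) then 1# else 0#

  blocks : ∀ {k l m n} → Matrix k m → Matrix k n → Matrix l m → Matrix l n →
           Matrix (k ℕ.+ l) (m ℕ.+ n)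
  blocks A B C D = zipWith _++_ A B ++ zipWith _++_ C D

  castᴹ : ∀ {m n} → m ≡ n → Matrix m m → Matrix n n
  castᴹ m≡n A i j = A (cast (≡.sym m≡n) i) (cast (≡.sym m≡n) j)

module Complex (ℝ : CompleteOrderedField) where
  open CompleteOrderedField ℝ
  open SquareRoot ℝ using (√)

  ℂ : Set
  ℂ = Carrier × Carrier

  ℂ-rawRing : RawRing 0ℓ 0ℓ
  ℂ-rawRing = record
    { Carrier = ℂ
    ; _≈_     = λ (a , b) (c , d) → a ≈ c × b ≈ d
    ; _+_     = λ (a , b) (c , d) → a + c , b + d
    ; _*_     = λ (a , b) (c , d) → a * c - b * d , a * d + b * c
    ; -_      = λ (a , b) → - a , - b
    ; 0#      = 0# , 0#
    ; 1#      = 1# , 0#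
    }

  fromReal : Carrier → ℂ
  fromReal a = a , 0#

  modulus : ℂ → Carrier
  modulus (a , b) = √ (a * a + b * b)

module SpectralRadius (ℝ : CompleteOrderedField) where
  open CompleteOrderedField ℝ
  open Complex ℝ
  open Matrices rawRing using (Matrix)
  open Matrices ℂ-rawRing using (0ᵛ; _≈ᵛ_; _*ᵛ_; _·ᵛ_)

  IsEigenvalue : ∀ {n} → Matrix n n → ℂ → Set
  IsEigenvalue {n} C λ′ = Σ[ x ∈ Vector ℂ n ]
    ¬ (x ≈ᵛ 0ᵛ) × (λ i j → fromReal (C i j)) *ᵛ x ≈ᵛ λ′ ·ᵛ x

  -- r is the maximum of the moduli of the complex eigenvalues of C; in
  -- particular there is no such r when n ≡ 0.
  IsSpectralRadius : ∀ {n} → Matrix n n → Carrier → Set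
  IsSpectralRadius C r =
    (Σ[ μ ∈ ℂ ] IsEigenvalue C μ × modulus μ ≈ r) ×
    (∀ μ → IsEigenvalue C μ → modulus μ ≤ r)

-- Let x be an eigenvector with |λ| = ρ and y = |x|.  Then ρ y ≤ C y, and C ≤ F entrywise,
-- where F = f J + (d - f) I.  At an index i where y attains its maximum M,
--   ρ² M ≤ ρ (C y)ᵢ ≤ (F ρ y)ᵢ = f Σⱼ ρ yⱼ + (d - f) ρ M ≤ f m M + (d - f) ρ M,
-- so ρ² ≤ (d - f) ρ + m f.  When equality holds every step is tight: C agrees with F on the
-- set S = { i | yᵢ = M }, and vanishes elsewhere.  Conversely the indicator vector of S is then
-- an eigenvector for (k - 1) f + d, which is the larger root of t² = (d - f) t + m f.

module Submission where

-- The extra factor ρ is what brings the entry sum into the estimate. The plain chain ρy ≤ Cy ≤ Fy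
-- leaves f Σⱼ yⱼ, which is controlled only through n. With ρyⱼ in place of yⱼ, subinvariance can be
-- applied to every row at once: Σⱼ ρyⱼ is at most the total of Cy, and hence at most m M. Two signs
-- shape the rest. That of d - f is unknown, so its term is never estimated; at a maximum of y it is
-- known exactly. That of f is forced by an off-diagonal entry or by mf > 0, so the upper bound for
-- n = 1 needs its own argument. Taking moduli gives only a subinvariant vector. In the extremal
-- case the eigenvector equation Cy = ρy is recovered because no slack is left in the sum over all
-- rows.

open import Defs
open import Algebra.Bundles using (CommutativeRing; RawRing)
import Algebra.Definitions.RawMonoid as RawMonoidDefs
import Algebra.Properties.CommutativeSemigroup as CommutativeSemigroupProperties
import Algebra.Properties.Ring as RingProperties
import Algebra.Properties.Semiring.Mult.TCOptimised as Mult
import Algebra.Properties.Semiring.Sum as SemiringSum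
import Algebra.Solver.Ring
open import Algebra.Solver.Ring.AlmostCommutativeRing
  using (fromCommutativeRing; _-Raw-AlmostCommutative⟶_)
open import Data.Bool.Base using (if_then_else_)
open import Data.Fin.Base as Fin using (Fin; zero; suc; toℕ; fromℕ<; cast; punchIn; punchOut)
import Data.Fin.Properties as Fin
open import Data.Fin.Permutation as Perm using (Permutation′; _⟨$⟩ʳ_; _⟨$⟩ˡ_)
open import Data.Integer.Base as ℤ using (ℤ; +_; -[1+_]; _⊖_)
import Data.Integer.Properties as ℤ
open import Data.Maybe.Base as Maybe using ()
open import Data.Nat.Base as ℕ using (ℕ; _∸_; z≤n; s≤s)
import Data.Nat.Properties as ℕ
open import Data.Nat.Properties using (m+[n∸m]≡n)
open import Data.Product.Base using (Σ-syntax; ∃; _×_; _,_; proj₁; proj₂)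
open import Data.Sum.Base using (_⊎_; inj₁; inj₂)
open import Data.Vec.Functional using (Vector; transpose; zipWith; _++_)
open import Data.Vec.Functional.Properties using (lookup-++-<; lookup-++-≥)
open import Function.Base using (_∘_)
open import Function.Bundles using (_⇔_; mk⇔; Equivalence; Injection)
open import Function.Properties.Inverse using (↔⇒↣)
open import Relation.Binary.Bundles using (Poset)
import Relation.Binary.Reasoning.PartialOrder as ≤-ReasoningOf
import Relation.Binary.Reasoning.Setoid as ≈-ReasoningOf
open import Relation.Binary.PropositionalEquality.Core as ≡ using (_≡_; _≢_)
open import Relation.Binary.Structures using (IsDecTotalOrder)
open import Relation.Nullary using (¬_; Dec; does; yes; no; contradiction)
open import Relation.Nullary.Decidable using (dec⇒maybe; dec-true; dec-false)
open import Relation.Unary using (Pred; Decidable)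

-- Integer coefficients make the solver cancel opposite terms in an abstract commutative ring,
-- whose own coefficients have no computing equality test.
module IntegerSolver {c ℓ} (R : CommutativeRing c ℓ) where
  open CommutativeRing R
  open RingProperties ring
    using (-‿distribˡ-*; -‿distribʳ-*; -‿involutive; -0#≈0#; -‿+-comm)
  open CommutativeSemigroupProperties +-commutativeSemigroup using (interchange)
  open Mult semiring renaming (_×_ to _×#_)
  open ≈-ReasoningOf setoid

  ⟦_⟧ℤ : ℤ → Carrier
  ⟦ + n ⟧ℤ      = n ×# 1#
  ⟦ -[1+ n ] ⟧ℤ = - (ℕ.suc n ×# 1#)

  ⟦-⟧ : ∀ i → ⟦ ℤ.- i ⟧ℤ ≈ - ⟦ i ⟧ℤ
  ⟦-⟧ (+ ℕ.zero)  = sym -0#≈0#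
  ⟦-⟧ (+ ℕ.suc n) = refl
  ⟦-⟧ -[1+ n ]    = sym (-‿involutive _)

  ⟦⊖⟧ : ∀ m n → ⟦ m ⊖ n ⟧ℤ ≈ m ×# 1# - n ×# 1#
  ⟦⊖⟧ m ℕ.zero = sym (trans (+-congˡ -0#≈0#) (+-identityʳ _))
  ⟦⊖⟧ ℕ.zero (ℕ.suc n) = sym (+-identityˡ _)
  ⟦⊖⟧ (ℕ.suc m) (ℕ.suc n) = begin
    ⟦ ℕ.suc m ⊖ ℕ.suc n ⟧ℤ
      ≡⟨ ≡.cong ⟦_⟧ℤ (ℤ.[1+m]⊖[1+n]≡m⊖n m n) ⟩
    ⟦ m ⊖ n ⟧ℤ
      ≈⟨ ⟦⊖⟧ m n ⟩
    m ×# 1# - n ×# 1#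
      ≈⟨ +-identityˡ _ ⟨
    0# + (m ×# 1# - n ×# 1#)
      ≈⟨ +-congʳ (-‿inverseʳ 1#) ⟨
    (1# - 1#) + (m ×# 1# - n ×# 1#)
      ≈⟨ interchange _ _ _ _ ⟩
    (1# + m ×# 1#) + (- 1# - n ×# 1#)
      ≈⟨ +-cong (sym (1+× m 1#)) (trans (-‿+-comm _ _) (-‿cong (sym (1+× n 1#)))) ⟩
    ℕ.suc m ×# 1# - ℕ.suc n ×# 1# ∎

  ⟦+⟧ : ∀ i j → ⟦ i ℤ.+ j ⟧ℤ ≈ ⟦ i ⟧ℤ + ⟦ j ⟧ℤ
  ⟦+⟧ (+ m)    (+ n)    = ×-homo-+ 1# m n
  ⟦+⟧ (+ m)    -[1+ n ] = ⟦⊖⟧ m (ℕ.suc n)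
  ⟦+⟧ -[1+ m ] (+ n)    = trans (⟦⊖⟧ n (ℕ.suc m)) (+-comm _ _)
  ⟦+⟧ -[1+ m ] -[1+ n ] = begin
    - (ℕ.suc (ℕ.suc (m ℕ.+ n)) ×# 1#)
      ≡⟨ ≡.cong (λ k → - (ℕ.suc k ×# 1#)) (ℕ.+-suc m n) ⟨
    - ((ℕ.suc m ℕ.+ ℕ.suc n) ×# 1#)
      ≈⟨ -‿cong (×-homo-+ 1# (ℕ.suc m) (ℕ.suc n)) ⟩
    - (ℕ.suc m ×# 1# + ℕ.suc n ×# 1#)
      ≈⟨ -‿+-comm _ _ ⟨
    - (ℕ.suc m ×# 1#) - ℕ.suc n ×# 1# ∎

  ⟦*+⟧ : ∀ i n → ⟦ i ℤ.* + n ⟧ℤ ≈ ⟦ i ⟧ℤ * n ×# 1#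
  ⟦*+⟧ (+ m) n = trans (reflexive (≡.cong ⟦_⟧ℤ (≡.sym (ℤ.pos-* m n)))) (×1-homo-* m n)
  ⟦*+⟧ -[1+ m ] n = begin
    ⟦ -[1+ m ] ℤ.* + n ⟧ℤ          ≡⟨ ≡.cong ⟦_⟧ℤ (ℤ.neg-distribˡ-* (+ ℕ.suc m) (+ n)) ⟨
    ⟦ ℤ.- (+ ℕ.suc m ℤ.* + n) ⟧ℤ   ≈⟨ ⟦-⟧ (+ ℕ.suc m ℤ.* + n) ⟩
    - ⟦ + ℕ.suc m ℤ.* + n ⟧ℤ       ≈⟨ -‿cong (⟦*+⟧ (+ ℕ.suc m) n) ⟩
    - (ℕ.suc m ×# 1# * n ×# 1#)    ≈⟨ -‿distribˡ-* _ _ ⟩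
    - (ℕ.suc m ×# 1#) * n ×# 1#    ∎

  ⟦*⟧ : ∀ i j → ⟦ i ℤ.* j ⟧ℤ ≈ ⟦ i ⟧ℤ * ⟦ j ⟧ℤ
  ⟦*⟧ i (+ n) = ⟦*+⟧ i n
  ⟦*⟧ i -[1+ n ] = begin
    ⟦ i ℤ.* -[1+ n ] ⟧ℤ            ≡⟨ ≡.cong ⟦_⟧ℤ (ℤ.neg-distribʳ-* i (+ ℕ.suc n)) ⟨
    ⟦ ℤ.- (i ℤ.* + ℕ.suc n) ⟧ℤ     ≈⟨ ⟦-⟧ (i ℤ.* + ℕ.suc n) ⟩
    - ⟦ i ℤ.* + ℕ.suc n ⟧ℤ         ≈⟨ -‿cong (⟦*+⟧ i (ℕ.suc n)) ⟩
    - (⟦ i ⟧ℤ * ℕ.suc n ×# 1#)     ≈⟨ -‿distribʳ-* _ _ ⟩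
    ⟦ i ⟧ℤ * - (ℕ.suc n ×# 1#)     ∎

  -- The optimised multiple reduces `1 ×# 1#` to `1#`, so the units are preserved by `refl` and
  -- `con (+ 1)` denotes `1#` itself.
  homomorphism : ℤ.+-*-rawRing -Raw-AlmostCommutative⟶ fromCommutativeRing R
  homomorphism = record
    { ⟦_⟧    = ⟦_⟧ℤ
    ; +-homo = ⟦+⟧
    ; *-homo = ⟦*⟧
    ; -‿homo = ⟦-⟧
    ; 0-homo = refl
    ; 1-homo = refl
    }

  open Algebra.Solver.Ring ℤ.+-*-rawRing (fromCommutativeRing R) homomorphism
    (λ i j → Maybe.map (reflexive ∘ ≡.cong ⟦_⟧ℤ) (dec⇒maybe (i ℤ.≟ j))) public

-- Ordered-field arithmetic, finite sums and maxima

module OrderedField (ℝ : CompleteOrderedField) where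
  open CompleteOrderedField ℝ public renaming (zero to *-zero)
  open SquareRoot ℝ public using (√; √-nonneg; √-square)
  open IntegerSolver commutativeRing public using (solve; _:=_; _:+_; _:*_; _:-_; con)
  open IsDecTotalOrder isDecTotalOrder public
    using (total; antisym; ≤-respˡ-≈; ≤-respʳ-≈; isPartialOrder)
    renaming (refl to ≤-refl; reflexive to ≤-reflexive; trans to ≤-trans; _≟_ to _≈?_)

  poset : Poset _ _ _
  poset = record { isPartialOrder = isPartialOrder }

  module ≤-Reasoning = ≤-ReasoningOf poset
  module ≈-Reasoning = ≈-ReasoningOf setoid

  ≤-resp : ∀ {x x′ y y′} → x ≈ x′ → y ≈ y′ → x ≤ y → x′ ≤ y′
  ≤-resp p q = ≤-respˡ-≈ p ∘ ≤-respʳ-≈ q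

  x≤y⇒0≤y-x : ∀ {x y} → x ≤ y → 0# ≤ y - x
  x≤y⇒0≤y-x {x} x≤y = ≤-respˡ-≈ (-‿inverseʳ x) (+-monoˡ-≤ (- x) x≤y)

  0≤y-x⇒x≤y : ∀ {x y} → 0# ≤ y - x → x ≤ y
  0≤y-x⇒x≤y {x} {y} 0≤y-x = ≤-resp (+-identityˡ x)
    (solve 2 (λ x y → y :- x :+ x := y) refl x y) (+-monoˡ-≤ x 0≤y-x)

  +-mono-≤ : ∀ {x x′ y y′} → x ≤ x′ → y ≤ y′ → x + y ≤ x′ + y′
  +-mono-≤ {x} {x′} {y} {y′} x≤x′ y≤y′ =
    ≤-trans (+-monoˡ-≤ y x≤x′) (≤-resp (+-comm y x′) (+-comm y′ x′) (+-monoˡ-≤ x′ y≤y′))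

  +-nonneg : ∀ {x y} → 0# ≤ x → 0# ≤ y → 0# ≤ x + y
  +-nonneg 0≤x 0≤y = ≤-respˡ-≈ (+-identityˡ 0#) (+-mono-≤ 0≤x 0≤y)

  +-cancelʳ-≤ : ∀ {x y} z → x + z ≤ y + z → x ≤ y
  +-cancelʳ-≤ {x} {y} z x+z≤y+z = ≤-resp (undo x) (undo y) (+-monoˡ-≤ (- z) x+z≤y+z)
    where
    undo : ∀ x → x + z - z ≈ x
    undo x = solve 2 (λ x z → x :+ z :- z := x) refl x z

  +-cancelˡ-≤ : ∀ {x y} z → z + x ≤ z + y → x ≤ y
  +-cancelˡ-≤ {x} {y} z = +-cancelʳ-≤ z ∘ ≤-resp (+-comm z x) (+-comm z y)

  *-monoˡ-≤ : ∀ {x y z} → 0# ≤ z → x ≤ y → z * x ≤ z * y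
  *-monoˡ-≤ {x} {y} {z} 0≤z x≤y = 0≤y-x⇒x≤y (≤-respʳ-≈
    (solve 3 (λ x y z → z :* (y :- x) := z :* y :- z :* x) refl x y z)
    (*-nonneg 0≤z (x≤y⇒0≤y-x x≤y)))

  *-monoʳ-≤ : ∀ {x y z} → 0# ≤ z → x ≤ y → x * z ≤ y * z
  *-monoʳ-≤ {x} {y} {z} 0≤z x≤y = ≤-resp (*-comm z x) (*-comm z y) (*-monoˡ-≤ 0≤z x≤y)

  *-cancelˡ-≈ : ∀ {x y z} → z ≉ 0# → z * x ≈ z * y → x ≈ y
  *-cancelˡ-≈ {x} {y} {z} z≉0 zx≈zy =
    trans (undo x) (trans (*-congˡ zx≈zy) (sym (undo y)))
    where
    undo : ∀ x → x ≈ z ⁻¹ * (z * x)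
    undo x = trans (sym (*-identityˡ x)) (trans (*-congʳ (sym (⁻¹-inverseʳ z≉0)))
      (solve 3 (λ x z w → z :* w :* x := w :* (z :* x)) refl x z (z ⁻¹)))

  -- Totality replaces positivity of the inverse: if `y ≤ x`, monotonicity turns the hypothesis into
  -- an equation, and equations cancel.
  *-cancelˡ-≤ : ∀ {x y z} → 0# < z → z * x ≤ z * y → x ≤ y
  *-cancelˡ-≤ {x} {y} (0≤z , 0≉z) zx≤zy with total x y
  ... | inj₁ x≤y = x≤y
  ... | inj₂ y≤x = ≤-reflexive
    (*-cancelˡ-≈ (0≉z ∘ sym) (antisym zx≤zy (*-monoˡ-≤ 0≤z y≤x)))

  x*y≈0⇒y≈0 : ∀ {x y} → x ≉ 0# → x * y ≈ 0# → y ≈ 0#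
  x*y≈0⇒y≈0 x≉0 xy≈0 = *-cancelˡ-≈ x≉0 (trans xy≈0 (sym (zeroʳ _)))

  0≤x² : ∀ x → 0# ≤ x * x
  0≤x² x with total 0# x
  ... | inj₁ 0≤x = *-nonneg 0≤x 0≤x
  ... | inj₂ x≤0 = ≤-respʳ-≈
    (solve 1 (λ x → (con (+ 0) :- x) :* (con (+ 0) :- x) := x :* x) refl x)
    (*-nonneg (x≤y⇒0≤y-x x≤0) (x≤y⇒0≤y-x x≤0))

  0<1 : 0# < 1#
  0<1 = ≤-respʳ-≈ (*-identityˡ 1#) (0≤x² 1#) , 1≉0 ∘ sym

  ≤-<-trans-0 : ∀ {x y} → 0# < x → x ≤ y → 0# < y
  ≤-<-trans-0 (0≤x , 0≉x) x≤y =
    ≤-trans 0≤x x≤y , λ 0≈y → 0≉x (antisym 0≤x (≤-respʳ-≈ (sym 0≈y) x≤y))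

  fromℕ-nonneg : ∀ k → 0# ≤ fromℕ k
  fromℕ-nonneg ℕ.zero    = ≤-refl
  fromℕ-nonneg (ℕ.suc k) = +-nonneg (proj₁ 0<1) (fromℕ-nonneg k)

  fromℕ-suc-positive : ∀ k → 0# < fromℕ (ℕ.suc k)
  fromℕ-suc-positive k = ≤-<-trans-0 0<1
    (≤-respˡ-≈ (+-identityʳ 1#) (+-mono-≤ ≤-refl (fromℕ-nonneg k)))

  -- When `y ≤ x`, the products are squeezed as x² ≤ y² ≤ xy, and a nonzero `x` cancels.
  ²-cancel-≤ : ∀ {x y} → 0# ≤ y → x * x ≤ y * y → x ≤ y
  ²-cancel-≤ {x} {y} 0≤y x²≤y² with total x y
  ... | inj₁ x≤y = x≤y
  ... | inj₂ y≤x with 0# ≈? x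
  ...   | yes 0≈x = ≤-respˡ-≈ 0≈x 0≤y
  ...   | no  0≉x = *-cancelˡ-≤ (≤-trans 0≤y y≤x , 0≉x) (≤-trans x²≤y² (*-monoʳ-≤ 0≤y y≤x))

  ²-injective : ∀ {x y} → 0# ≤ x → 0# ≤ y → x * x ≈ y * y → x ≈ y
  ²-injective 0≤x 0≤y x²≈y² = antisym (²-cancel-≤ 0≤y (≤-reflexive x²≈y²))
    (²-cancel-≤ 0≤x (≤-reflexive (sym x²≈y²)))

  √-unique : ∀ {x r} → 0# ≤ r → r * r ≈ x → √ x ≈ r
  √-unique {x} {r} 0≤r r²≈x = ²-injective (√-nonneg x) 0≤r
    (trans (√-square (≤-respʳ-≈ r²≈x (0≤x² r))) (sym r²≈x))

  +-nonneg-≈0 : ∀ {x y} → 0# ≤ x → 0# ≤ y → x + y ≈ 0# → x ≈ 0#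
  +-nonneg-≈0 {x} 0≤x 0≤y x+y≈0 = antisym
    (≤-resp (+-identityʳ x) x+y≈0 (+-mono-≤ ≤-refl 0≤y)) 0≤x

  x²≈0⇒x≈0 : ∀ {x} → x * x ≈ 0# → x ≈ 0#
  x²≈0⇒x≈0 {x} x²≈0 with x ≈? 0#
  ... | yes x≈0 = x≈0
  ... | no  x≉0 = x*y≈0⇒y≈0 x≉0 x²≈0

  open SemiringSum semiring public using
    (sum; sum-cong-≋; ∑-distrib-+; sum-permute; *-distribˡ-sum; *-distribʳ-sum; sum-replicate-zero)

  sum-mono-≤ : ∀ {n} {x y : Vector Carrier n} → (∀ i → x i ≤ y i) → sum x ≤ sum y
  sum-mono-≤ {ℕ.zero}  x≤y = ≤-refl
  sum-mono-≤ {ℕ.suc n} x≤y = +-mono-≤ (x≤y zero) (sum-mono-≤ (x≤y ∘ suc))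

  -- Slack at one index cannot be made up at another. Every pointwise conclusion of the equality
  -- case is drawn from this.
  sum-mono-≤-tight : ∀ {n} {x y : Vector Carrier n} → (∀ i → x i ≤ y i) →
                     sum y ≤ sum x → ∀ i → x i ≈ y i
  sum-mono-≤-tight {ℕ.suc n} {x} {y} x≤y Σy≤Σx zero = antisym (x≤y zero)
    (+-cancelʳ-≤ _ (≤-trans Σy≤Σx (+-mono-≤ ≤-refl (sum-mono-≤ (x≤y ∘ suc)))))
  sum-mono-≤-tight {ℕ.suc n} {x} {y} x≤y Σy≤Σx (suc i) =
    sum-mono-≤-tight (x≤y ∘ suc)
      (+-cancelˡ-≤ _ (≤-trans Σy≤Σx (+-mono-≤ (x≤y zero) ≤-refl))) i

  sum-≈0 : ∀ {n} {x : Vector Carrier n} → (∀ i → x i ≈ 0#) → sum x ≈ 0#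
  sum-≈0 {n} x≈0 = trans (sum-cong-≋ x≈0) (sum-replicate-zero n)

  sum-nonneg : ∀ {n} {x : Vector Carrier n} → (∀ i → 0# ≤ x i) → 0# ≤ sum x
  sum-nonneg {n} 0≤x = ≤-respˡ-≈ (sum-replicate-zero n) (sum-mono-≤ 0≤x)

  sum-nonneg-≈0 : ∀ {n} {x : Vector Carrier n} → (∀ i → 0# ≤ x i) → sum x ≈ 0# → ∀ i → x i ≈ 0#
  sum-nonneg-≈0 {n} 0≤x Σx≈0 i = sym (sum-mono-≤-tight 0≤x
    (≤-reflexive (trans Σx≈0 (sym (sum-replicate-zero n)))) i)

  maximum : ∀ {n} (y : Vector Carrier (ℕ.suc n)) → ∃ λ i → ∀ j → y j ≤ y i
  maximum {ℕ.zero}  y = zero , λ { zero → ≤-refl }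
  maximum {ℕ.suc n} y with maximum (y ∘ suc)
  ... | i , max with total (y zero) (y (suc i))
  ...   | inj₁ y₀≤yᵢ = suc i , λ { zero → y₀≤yᵢ ; (suc j) → max j }
  ...   | inj₂ yᵢ≤y₀ = zero  , λ { zero → ≤-refl ; (suc j) → ≤-trans (max j) yᵢ≤y₀ }

-- The modulus of complex numbers

module Modulus (ℝ : CompleteOrderedField) where
  open OrderedField ℝ
  open Complex ℝ
  open RawRing ℂ-rawRing using ()
    renaming (_≈_ to _≈ᶜ_; _+_ to _+ᶜ_; _*_ to _*ᶜ_; 0# to 0ᶜ; +-rawMonoid to ℂ-+-rawMonoid)
  open RawMonoidDefs ℂ-+-rawMonoid using () renaming (sum to sumᶜ)

  modulus-nonneg : ∀ z → 0# ≤ modulus z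
  modulus-nonneg (a , b) = √-nonneg (a * a + b * b)

  normSq-nonneg : ∀ a b → 0# ≤ a * a + b * b
  normSq-nonneg a b = +-nonneg (0≤x² a) (0≤x² b)

  modulus-square : ∀ a b → modulus (a , b) * modulus (a , b) ≈ a * a + b * b
  modulus-square a b = √-square (normSq-nonneg a b)

  modulus-cong : ∀ {z w} → z ≈ᶜ w → modulus z ≈ modulus w
  modulus-cong {a , b} {c , d} (a≈c , b≈d) = √-unique (modulus-nonneg (c , d))
    (trans (modulus-square c d) (sym (+-cong (*-cong a≈c a≈c) (*-cong b≈d b≈d))))

  modulus≈0⇒≈0 : ∀ {z} → modulus z ≈ 0# → z ≈ᶜ 0ᶜ
  modulus≈0⇒≈0 {a , b} ∣z∣≈0 =
    x²≈0⇒x≈0 (+-nonneg-≈0 (0≤x² a) (0≤x² b) a²+b²≈0) ,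
    x²≈0⇒x≈0 (+-nonneg-≈0 (0≤x² b) (0≤x² a) (trans (+-comm _ _) a²+b²≈0))
    where
    a²+b²≈0 : a * a + b * b ≈ 0#
    a²+b²≈0 = trans (sym (modulus-square a b)) (trans (*-congʳ ∣z∣≈0) (zeroˡ _))

  modulus-fromReal : ∀ {a} → 0# ≤ a → modulus (fromReal a) ≈ a
  modulus-fromReal {a} 0≤a = √-unique 0≤a
    (solve 1 (λ a → a :* a := a :* a :+ con (+ 0) :* con (+ 0)) refl a)

  -- Both sides are nonnegative, so it suffices to compare squares; these agree by the
  -- Brahmagupta-Fibonacci two-square identity.
  modulus-* : ∀ z w → modulus (z *ᶜ w) ≈ modulus z * modulus w
  modulus-* (a , b) (c , d) = √-unique
    (*-nonneg (modulus-nonneg (a , b)) (modulus-nonneg (c , d))) (begin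
      r * s * (r * s)
        ≈⟨ solve 2 (λ r s → r :* s :* (r :* s) := r :* r :* (s :* s)) refl r s ⟩
      r * r * (s * s)
        ≈⟨ *-cong (modulus-square a b) (modulus-square c d) ⟩
      (a * a + b * b) * (c * c + d * d)
        ≈⟨ solve 4 (λ a b c d → (a :* a :+ b :* b) :* (c :* c :+ d :* d)
             := (a :* c :- b :* d) :* (a :* c :- b :* d)
             :+ (a :* d :+ b :* c) :* (a :* d :+ b :* c)) refl a b c d ⟩
      (a * c - b * d) * (a * c - b * d) + (a * d + b * c) * (a * d + b * c) ∎)
    where
    open ≈-Reasoning
    r = modulus (a , b)
    s = modulus (c , d)

  -- Cauchy-Schwarz in the plane: by Lagrange's identity the gap between the squares is (ad - bc)².
  inner≤modulus : ∀ a b c d → a * c + b * d ≤ modulus (a , b) * modulus (c , d)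
  inner≤modulus a b c d =
    ²-cancel-≤ (*-nonneg (modulus-nonneg (a , b)) (modulus-nonneg (c , d))) (begin
      (a * c + b * d) * (a * c + b * d)
        ≤⟨ ≤-respˡ-≈ (+-identityˡ _) (+-monoˡ-≤ _ (0≤x² (a * d - b * c))) ⟩
      (a * d - b * c) * (a * d - b * c) + (a * c + b * d) * (a * c + b * d)
        ≈⟨ solve 4 (λ a b c d → (a :* d :- b :* c) :* (a :* d :- b :* c)
             :+ (a :* c :+ b :* d) :* (a :* c :+ b :* d)
             := (a :* a :+ b :* b) :* (c :* c :+ d :* d)) refl a b c d ⟩
      (a * a + b * b) * (c * c + d * d)
        ≈⟨ *-cong (modulus-square a b) (modulus-square c d) ⟨
      r * r * (s * s)
        ≈⟨ solve 2 (λ r s → r :* r :* (s :* s) := r :* s :* (r :* s)) refl r s ⟩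
      r * s * (r * s) ∎)
    where
    open ≤-Reasoning
    r = modulus (a , b)
    s = modulus (c , d)

  modulus-+-≤ : ∀ z w → modulus (z +ᶜ w) ≤ modulus z + modulus w
  modulus-+-≤ (a , b) (c , d) =
    ²-cancel-≤ (+-nonneg (modulus-nonneg (a , b)) (modulus-nonneg (c , d))) (begin
      modulus (a + c , b + d) * modulus (a + c , b + d)
        ≈⟨ modulus-square (a + c) (b + d) ⟩
      (a + c) * (a + c) + (b + d) * (b + d)
        ≈⟨ solve 4 (λ a b c d → (a :+ c) :* (a :+ c) :+ (b :+ d) :* (b :+ d)
             := (a :* a :+ b :* b) :+ (c :* c :+ d :* d)
             :+ ((a :* c :+ b :* d) :+ (a :* c :+ b :* d))) refl a b c d ⟩
      (a * a + b * b) + (c * c + d * d) + ((a * c + b * d) + (a * c + b * d))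
        ≤⟨ +-mono-≤ (≤-reflexive (sym (+-cong (modulus-square a b) (modulus-square c d))))
             (+-mono-≤ (inner≤modulus a b c d) (inner≤modulus a b c d)) ⟩
      r * r + s * s + (r * s + r * s)
        ≈⟨ solve 2 (λ r s → r :* r :+ s :* s :+ (r :* s :+ r :* s)
             := (r :+ s) :* (r :+ s)) refl r s ⟩
      (r + s) * (r + s) ∎)
    where
    open ≤-Reasoning
    r = modulus (a , b)
    s = modulus (c , d)

  modulus-sum-≤ : ∀ {n} (z : Vector ℂ n) → modulus (sumᶜ z) ≤ sum (modulus ∘ z)
  modulus-sum-≤ {ℕ.zero}  z = ≤-reflexive (modulus-fromReal ≤-refl)
  modulus-sum-≤ {ℕ.suc n} z =
    ≤-trans (modulus-+-≤ (z zero) (sumᶜ (z ∘ suc))) (+-mono-≤ ≤-refl (modulus-sum-≤ (z ∘ suc)))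

  proj₁-sum : ∀ {n} (z : Vector ℂ n) → proj₁ (sumᶜ z) ≈ sum (proj₁ ∘ z)
  proj₁-sum {ℕ.zero}  z = refl
  proj₁-sum {ℕ.suc n} z = +-congˡ (proj₁-sum (z ∘ suc))

  proj₂-sum : ∀ {n} (z : Vector ℂ n) → proj₂ (sumᶜ z) ≈ sum (proj₂ ∘ z)
  proj₂-sum {ℕ.zero}  z = refl
  proj₂-sum {ℕ.suc n} z = +-congˡ (proj₂-sum (z ∘ suc))

-- From complex eigenvectors to real vectors and back

module Eigenvalues (ℝ : CompleteOrderedField) where
  open OrderedField ℝ
  open Complex ℝ
  open Modulus ℝ
  open Matrices rawRing
  open Matrices ℂ-rawRing using () renaming (_≈ᵛ_ to _≈ᶜᵛ_; _*ᵛ_ to _*ᶜᵛ_; _·ᵛ_ to _·ᶜᵛ_)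
  open RawRing ℂ-rawRing using () renaming (_*_ to _⊗_)
  open SpectralRadius ℝ

  -- The triangle inequality in each row discards the phases of `x`, while the nonnegative entries
  -- of `C` pass through the modulus unchanged.
  modulus-subinvariant : ∀ {n} {C : Matrix n n} → (∀ i j → 0# ≤ C i j) →
    ∀ μ x → (λ i j → fromReal (C i j)) *ᶜᵛ x ≈ᶜᵛ μ ·ᶜᵛ x →
    ∀ i → modulus μ * modulus (x i) ≤ (C *ᵛ (modulus ∘ x)) i
  modulus-subinvariant {C = C} 0≤C μ x Cx≈μx i = begin
    modulus μ * modulus (x i)
      ≈⟨ modulus-* μ (x i) ⟨
    modulus ((μ ·ᶜᵛ x) i)
      ≈⟨ modulus-cong (Cx≈μx i) ⟨
    modulus (((λ i j → fromReal (C i j)) *ᶜᵛ x) i)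
      ≤⟨ modulus-sum-≤ (λ j → fromReal (C i j) ⊗ x j) ⟩
    (sum λ j → modulus (fromReal (C i j) ⊗ x j))
      ≈⟨ sum-cong-≋ (λ j → trans (modulus-* (fromReal (C i j)) (x j))
           (*-congʳ (modulus-fromReal (0≤C i j)))) ⟩
    (C *ᵛ (modulus ∘ x)) i ∎
    where
    open ≤-Reasoning

  real-eigenvalue : ∀ {n} {C : Matrix n n} {μ v} → ¬ (v ≈ᵛ 0ᵛ) → C *ᵛ v ≈ᵛ μ ·ᵛ v →
                    IsEigenvalue C (fromReal μ)
  real-eigenvalue {C = C} {μ} {v} v≉0 Cv≈μv =
    fromReal ∘ v , (λ x≈0 → v≉0 (proj₁ ∘ x≈0)) , λ i →
      trans (proj₁-sum (λ j → fromReal (C i j) ⊗ fromReal (v j))) (trans (sum-cong-≋ (λ j → re (C i j) (v j)))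
        (trans (Cv≈μv i) (sym (re μ (v i))))) ,
      trans (proj₂-sum (λ j → fromReal (C i j) ⊗ fromReal (v j))) (trans (sum-≈0 (λ j → im (C i j) (v j))) (sym (im μ (v i))))
    where
    re : ∀ a b → a * b - 0# * 0# ≈ a * b
    re = solve 2 (λ a b → a :* b :- con (+ 0) :* con (+ 0) := a :* b) refl
    im : ∀ a b → a * 0# + 0# * b ≈ 0#
    im = solve 2 (λ a b → a :* con (+ 0) :+ con (+ 0) :* b := con (+ 0)) refl

-- Permutations sorting a decidable predicate to the front

punchIn-below : ∀ {n} (p : Fin (ℕ.suc n)) (i : Fin n) →
  (toℕ i ℕ.< toℕ p × toℕ (punchIn p i) ≡ toℕ i) ⊎
  (toℕ p ℕ.≤ toℕ i × toℕ (punchIn p i) ≡ ℕ.suc (toℕ i))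
punchIn-below zero    i       = inj₂ (z≤n , ≡.refl)
punchIn-below (suc p) zero    = inj₁ (s≤s z≤n , ≡.refl)
punchIn-below (suc p) (suc i) with punchIn-below p i
... | inj₁ (i<p , eq) = inj₁ (s≤s i<p , ≡.cong ℕ.suc eq)
... | inj₂ (p≤i , eq) = inj₂ (s≤s p≤i , ≡.cong ℕ.suc eq)

-- The element 0 is inserted at position k, the boundary between the two parts,
-- whether or not it satisfies P.
partition : ∀ {n ℓ} {P : Pred (Fin n) ℓ} → Decidable P →
  Σ[ π ∈ Permutation′ n ] Σ[ k ∈ ℕ ] k ℕ.≤ n ×
    (∀ i → toℕ i ℕ.< k → P (π ⟨$⟩ʳ i)) × (∀ i → k ℕ.≤ toℕ i → ¬ P (π ⟨$⟩ʳ i))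
partition {ℕ.zero} P? = Perm.id , 0 , z≤n , (λ ()) , (λ ())
partition {ℕ.suc n} {P = P} P? with partition (P? ∘ suc)
... | π , k , k≤n , below , above = result
  where
  p : Fin (ℕ.suc n)
  p = fromℕ< (s≤s k≤n)

  p≡k : toℕ p ≡ k
  p≡k = Fin.toℕ-fromℕ< (s≤s k≤n)

  π⁺ : Permutation′ (ℕ.suc n)
  π⁺ = Perm.insert p zero π

  -- Letting `Q` relate a position to its image makes one case distinction at `p` serve both the
  -- claim below the boundary and the claim above it.
  split : (Q : Fin (ℕ.suc n) → Fin (ℕ.suc n) → Set _) → Q p zero →
          (∀ i → Q (punchIn p i) (suc (π ⟨$⟩ʳ i))) → ∀ i → Q i (π⁺ ⟨$⟩ʳ i)
  split Q at off i with p Fin.≟ i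
  ... | yes ≡.refl = at
  ... | no  p≢i    = ≡.subst (λ l → Q l (suc (π ⟨$⟩ʳ punchOut p≢i))) (Fin.punchIn-punchOut p≢i) (off (punchOut p≢i))

  -- `punchIn p` never hits position `k`, so off `p` the boundaries `k` and `suc k` separate the
  -- same indices. This lemma takes the boundary with the weaker hypothesis, as does `off-above`, so
  -- that each serves both outcomes of `P? zero`.
  off-below : ∀ i → toℕ (punchIn p i) ℕ.< ℕ.suc k → P (suc (π ⟨$⟩ʳ i))
  off-below i i<1+k with punchIn-below p i
  ... | inj₁ (i<p , _) = below i (≡.subst (toℕ i ℕ.<_) p≡k i<p)
  ... | inj₂ (_ , eq)  = below i (ℕ.s≤s⁻¹ (≡.subst (ℕ._< ℕ.suc k) eq i<1+k))

  off-above : ∀ i → k ℕ.≤ toℕ (punchIn p i) → ¬ P (suc (π ⟨$⟩ʳ i))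
  off-above i k≤i with punchIn-below p i
  ... | inj₁ (i<p , eq) = contradiction (≡.subst (k ℕ.≤_) eq k≤i)
                            (ℕ.<⇒≱ (≡.subst (toℕ i ℕ.<_) p≡k i<p))
  ... | inj₂ (p≤i , _)  = above i (≡.subst (ℕ._≤ toℕ i) p≡k p≤i)

  result : _
  result with P? zero
  ... | yes P0 = π⁺ , ℕ.suc k , s≤s k≤n ,
    split (λ i j → toℕ i ℕ.< ℕ.suc k → P j) (λ _ → P0) off-below ,
    split (λ i j → ℕ.suc k ℕ.≤ toℕ i → ¬ P j)
      (λ k<p _ → ℕ.<-irrefl (≡.sym p≡k) k<p) (λ i → off-above i ∘ ℕ.<⇒≤)
  ... | no ¬P0 = π⁺ , k , ℕ.m≤n⇒m≤1+n k≤n ,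
    split (λ i j → toℕ i ℕ.< k → P j)
      (λ p<k → contradiction p<k (ℕ.<-irrefl p≡k)) (λ i → off-below i ∘ ℕ.m<n⇒m<1+n) ,
    split (λ i j → k ℕ.≤ toℕ i → ¬ P j) (λ _ → ¬P0) off-above

-- The comparison matrix, the extremal block matrix and its eigenvector

module BlockMatrices (ℝ : CompleteOrderedField) where
  open OrderedField ℝ
  open Matrices rawRing

  I-diagonal : ∀ {n} (i : Fin n) → I n i i ≡ 1#
  I-diagonal i = ≡.cong (if_then 1# else 0#) (dec-true (i Fin.≟ i) ≡.refl)

  I-offDiagonal : ∀ {n} {i j : Fin n} → i ≢ j → I n i j ≡ 0#
  I-offDiagonal {i = i} {j} i≢j = ≡.cong (if_then 1# else 0#) (dec-false (i Fin.≟ j) i≢j)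

  I-*ᵛ : ∀ {n} (x : Vector Carrier n) i → (I n *ᵛ x) i ≈ x i
  I-*ᵛ x zero    = trans (+-cong (*-identityˡ _) (sum-≈0 (λ j → zeroˡ (x (suc j))))) (+-identityʳ _)
  I-*ᵛ x (suc i) = trans (+-cong (zeroˡ _) (I-*ᵛ (x ∘ suc) i)) (+-identityˡ _)

  -- At size `n` this is the `F` that dominates `C`; at size `k` it is the nonzero block of the
  -- extremal matrix.
  fill : ∀ n → Carrier → Carrier → Matrix n n
  fill n d f = f ·ᴹ J n +ᴹ (d - f) ·ᴹ I n

  fill-diagonal : ∀ {n} d f (i : Fin n) → fill n d f i i ≈ d
  fill-diagonal d f i = trans (+-congˡ (*-congˡ (reflexive (I-diagonal i))))
    (solve 2 (λ d f → f :* con (+ 1) :+ (d :- f) :* con (+ 1) := d) refl d f)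

  fill-offDiagonal : ∀ {n} d f {i j : Fin n} → i ≢ j → fill n d f i j ≈ f
  fill-offDiagonal d f i≢j = trans (+-congˡ (*-congˡ (reflexive (I-offDiagonal i≢j))))
    (solve 2 (λ d f → f :* con (+ 1) :+ (d :- f) :* con (+ 0) := f) refl d f)

  -- An entry depends only on whether its two indices coincide, so it survives a permutation as well
  -- as the passage between `Fin k` and `Fin n`.
  fill-reindex : ∀ {m n} d f {i i′ : Fin m} {j j′ : Fin n} → (i ≡ i′ ⇔ j ≡ j′) →
                 fill m d f i i′ ≈ fill n d f j j′
  fill-reindex d f {i} {i′} {j} {j′} i≡i′⇔j≡j′ with i Fin.≟ i′ | j Fin.≟ j′
  ... | yes _    | yes _    = refl
  ... | no _     | no _     = refl
  ... | yes i≡i′ | no j≢j′  = contradiction (Equivalence.to i≡i′⇔j≡j′ i≡i′) j≢j′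
  ... | no i≢i′  | yes j≡j′ = contradiction (Equivalence.from i≡i′⇔j≡j′ j≡j′) i≢i′

  fill-*ᵛ : ∀ {n} d f (x : Vector Carrier n) i →
            (fill n d f *ᵛ x) i ≈ f * sum x + (d - f) * x i
  fill-*ᵛ {n} d f x i = begin
    (sum λ j → (f * 1# + (d - f) * I n i j) * x j)
      ≈⟨ sum-cong-≋ (λ j → solve 4 (λ f e δ x → (f :* con (+ 1) :+ e :* δ) :* x
           := f :* x :+ e :* (δ :* x)) refl f (d - f) (I n i j) (x j)) ⟩
    (sum λ j → f * x j + (d - f) * (I n i j * x j))
      ≈⟨ ∑-distrib-+ (λ j → f * x j) (λ j → (d - f) * (I n i j * x j)) ⟩
    (sum λ j → f * x j) + (sum λ j → (d - f) * (I n i j * x j))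
      ≈⟨ +-cong (*-distribˡ-sum f x) (*-distribˡ-sum (d - f) (λ j → I n i j * x j)) ⟨
    f * sum x + (d - f) * (I n *ᵛ x) i
      ≈⟨ +-congˡ (*-congˡ (I-*ᵛ x i)) ⟩
    f * sum x + (d - f) * x i ∎
    where open ≈-Reasoning

  -- Row `i` of the permutation matrix is by definition row `π ⟨$⟩ʳ i` of the identity, so each of
  -- the two products selects a single term.
  permutation-conjugate : ∀ {n} (π : Permutation′ n) (C : Matrix n n) i j →
    (permutationMatrix π *ᴹ C *ᴹ transpose (permutationMatrix π)) i j ≈ C (π ⟨$⟩ʳ i) (π ⟨$⟩ʳ j)
  permutation-conjugate {n} π C i j = begin
    (sum λ l → (P *ᴹ C) i l * P j l)   ≈⟨ sum-cong-≋ (λ l → *-comm ((P *ᴹ C) i l) (P j l)) ⟩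
    (I n *ᵛ (P *ᴹ C) i) (π ⟨$⟩ʳ j)     ≈⟨ I-*ᵛ ((P *ᴹ C) i) (π ⟨$⟩ʳ j) ⟩
    (P *ᴹ C) i (π ⟨$⟩ʳ j)              ≈⟨ I-*ᵛ (λ l → C l (π ⟨$⟩ʳ j)) (π ⟨$⟩ʳ i) ⟩
    C (π ⟨$⟩ʳ i) (π ⟨$⟩ʳ j)            ∎
    where
    open ≈-Reasoning
    P = permutationMatrix π

  corner : ∀ {k n} → k ℕ.≤ n → Carrier → Carrier → Matrix n n
  corner {k} {n} k≤n d f = castᴹ (m+[n∸m]≡n k≤n)
    (blocks (fill k d f) (O k (n ∸ k)) (O (n ∸ k) k) (O (n ∸ k) (n ∸ k)))

  module _ {k n : ℕ} (k≤n : k ℕ.≤ n) (d f : Carrier) where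
    private
      cast′ : Fin n → Fin (k ℕ.+ (n ∸ k))
      cast′ = cast (≡.sym (m+[n∸m]≡n k≤n))

      cast-< : ∀ {i} → toℕ i ℕ.< k → toℕ (cast′ i) ℕ.< k
      cast-< {i} = ≡.subst (ℕ._< k) (≡.sym (Fin.toℕ-cast _ i))

      cast-≥ : ∀ {i} → k ℕ.≤ toℕ i → k ℕ.≤ toℕ (cast′ i)
      cast-≥ {i} = ≡.subst (k ℕ.≤_) (≡.sym (Fin.toℕ-cast _ i))

      toℕ-fromℕ<-cast : ∀ {i} (i<k : toℕ i ℕ.< k) → toℕ (fromℕ< (cast-< i<k)) ≡ toℕ i
      toℕ-fromℕ<-cast {i} i<k = ≡.trans (Fin.toℕ-fromℕ< (cast-< i<k)) (Fin.toℕ-cast _ i)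

      top : Matrix k (k ℕ.+ (n ∸ k))
      top = zipWith _++_ (fill k d f) (O k (n ∸ k))

      bottom : Matrix (n ∸ k) (k ℕ.+ (n ∸ k))
      bottom = zipWith _++_ (O (n ∸ k) k) (O (n ∸ k) (n ∸ k))

      corner-top : ∀ {i} (i<k : toℕ (cast′ i) ℕ.< k) j →
                   corner k≤n d f i j ≡ top (fromℕ< i<k) (cast′ j)
      corner-top {i} i<k j =
        ≡.cong (λ (row : Vector Carrier _) → row (cast′ j)) (lookup-++-< top bottom (cast′ i) i<k)

      bottom-zero : ∀ i j → bottom i j ≡ 0#
      bottom-zero i j with Fin.splitAt k j
      ... | inj₁ _ = ≡.refl
      ... | inj₂ _ = ≡.refl

    -- Together with the two vanishing lemmas below, this replaces the cast and the block
    -- concatenation by comparisons of `toℕ` with `k`; the later arguments see the block matrix only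
    -- in this form.
    corner-inside : ∀ {i j} → toℕ i ℕ.< k → toℕ j ℕ.< k → corner k≤n d f i j ≈ fill n d f i j
    corner-inside {i} {j} i<k j<k = begin
      corner k≤n d f i j
        ≡⟨ corner-top (cast-< i<k) j ⟩
      top (fromℕ< (cast-< i<k)) (cast′ j)
        ≡⟨ lookup-++-< (fill k d f (fromℕ< (cast-< i<k))) 0ᵛ (cast′ j) (cast-< j<k) ⟩
      fill k d f (fromℕ< (cast-< i<k)) (fromℕ< (cast-< j<k))
        ≈⟨ fill-reindex d f (mk⇔
             (λ eq → Fin.toℕ-injective (≡.trans (≡.sym (toℕ-fromℕ<-cast i<k))
               (≡.trans (≡.cong toℕ eq) (toℕ-fromℕ<-cast j<k))))
             (λ eq → Fin.toℕ-injective (≡.trans (toℕ-fromℕ<-cast i<k)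
               (≡.trans (≡.cong toℕ eq) (≡.sym (toℕ-fromℕ<-cast j<k)))))) ⟩
      fill n d f i j ∎
      where open ≈-Reasoning

    corner-rowOutside : ∀ {i} → k ℕ.≤ toℕ i → ∀ j → corner k≤n d f i j ≈ 0#
    corner-rowOutside {i} k≤i j = reflexive (≡.trans
      (≡.cong (λ (row : Vector Carrier _) → row (cast′ j))
        (lookup-++-≥ top bottom (cast′ i) (cast-≥ k≤i)))
      (bottom-zero (Fin.reduce≥ (cast′ i) (cast-≥ k≤i)) (cast′ j)))

    corner-columnOutside : ∀ i {j} → k ℕ.≤ toℕ j → corner k≤n d f i j ≈ 0#
    corner-columnOutside i {j} k≤j with toℕ i ℕ.<? k
    ... | yes i<k = reflexive (≡.trans (corner-top (cast-< i<k) j)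
      (lookup-++-≥ (fill k d f (fromℕ< (cast-< i<k))) 0ᵛ (cast′ j) (cast-≥ k≤j)))
    ... | no i≮k = corner-rowOutside (ℕ.≮⇒≥ i≮k) j

  initial : ∀ {n} → ℕ → Vector Carrier n
  initial k i = if does (toℕ i ℕ.<? k) then 1# else 0#

  initial-< : ∀ {k n} {i : Fin n} → toℕ i ℕ.< k → initial k i ≡ 1#
  initial-< {k} {i = i} i<k = ≡.cong (if_then 1# else 0#) (dec-true (toℕ i ℕ.<? k) i<k)

  initial-≥ : ∀ {k n} {i : Fin n} → k ℕ.≤ toℕ i → initial k i ≡ 0#
  initial-≥ {k} {i = i} k≤i = ≡.cong (if_then 1# else 0#) (dec-false (toℕ i ℕ.<? k) (ℕ.≤⇒≯ k≤i))

  -- The test `toℕ i <? k` computes when both sides are successors, so the tail of `initial (suc k)`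
  -- is `initial k` by definition.
  sum-initial : ∀ {k n} → k ℕ.≤ n → sum (initial {n} k) ≈ fromℕ k
  sum-initial {n = n} z≤n = sum-replicate-zero n
  sum-initial (s≤s k≤n)   = +-congˡ (sum-initial k≤n)

  -- In a row inside the block, the columns outside meet a zero of the vector, so the corner may be
  -- exchanged for the full `fill n d f`, whose action is known.
  corner-*ᵛ-initial : ∀ {k n} (k≤n : k ℕ.≤ n) d f →
    corner k≤n d f *ᵛ initial k ≈ᵛ (f * fromℕ k + (d - f)) ·ᵛ initial k
  corner-*ᵛ-initial {k} {n} k≤n d f i with toℕ i ℕ.<? k
  ... | no i≮k = trans
    (sum-≈0 (λ j → trans (*-congʳ (corner-rowOutside k≤n d f (ℕ.≮⇒≥ i≮k) j)) (zeroˡ _)))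
    (sym (trans (*-congˡ (reflexive (initial-≥ (ℕ.≮⇒≥ i≮k)))) (zeroʳ _)))
  ... | yes i<k = begin
    (corner k≤n d f *ᵛ initial k) i
      ≈⟨ sum-cong-≋ column ⟩
    (fill n d f *ᵛ initial k) i
      ≈⟨ fill-*ᵛ d f (initial k) i ⟩
    f * sum (initial {n} k) + (d - f) * initial k i
      ≈⟨ +-cong (*-congˡ (sum-initial k≤n)) (*-congˡ (reflexive (initial-< i<k))) ⟩
    f * fromℕ k + (d - f) * 1#
      ≈⟨ solve 3 (λ f k e → f :* k :+ e :* con (+ 1) := (f :* k :+ e) :* con (+ 1))
           refl f (fromℕ k) (d - f) ⟩
    (f * fromℕ k + (d - f)) * 1#
      ≈⟨ *-congˡ (reflexive (initial-< i<k)) ⟨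
    (f * fromℕ k + (d - f)) * initial k i ∎
    where
    open ≈-Reasoning
    column : ∀ j → corner k≤n d f i j * initial k j ≈ fill n d f i j * initial k j
    column j with toℕ j ℕ.<? k
    ... | yes j<k = *-congʳ (corner-inside k≤n d f i<k j<k)
    ... | no  j≮k = trans (vanish (corner k≤n d f i j)) (sym (vanish (fill n d f i j)))
      where
      vanish : ∀ x → x * initial k j ≈ 0#
      vanish x = trans (*-congˡ (reflexive (initial-≥ (ℕ.≮⇒≥ j≮k)))) (zeroʳ x)

  -- The indicator of the first `k` positions is carried along `π` by a change of summation index.
  -- Necessity uses this eigenvector to identify ρ, sufficiency to exhibit an eigenvalue.
  corner-eigenvector : ∀ {n} {C : Matrix n n} (π : Permutation′ n) {k} (k≤n : k ℕ.≤ n) d f →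
    (∀ i j → C (π ⟨$⟩ʳ i) (π ⟨$⟩ʳ j) ≈ corner k≤n d f i j) →
    let v = λ i → initial k (π ⟨$⟩ˡ i) in C *ᵛ v ≈ᵛ (f * fromℕ k + (d - f)) ·ᵛ v
  corner-eigenvector {n} {C} π {k} k≤n d f C≈ i = begin
    (sum λ j → C i j * v j)
      ≈⟨ sum-permute (λ j → C i j * v j) π ⟩
    (sum λ j → C i (π ⟨$⟩ʳ j) * v (π ⟨$⟩ʳ j))
      ≈⟨ sum-cong-≋ (λ j → *-cong
           (trans (reflexive (≡.cong (λ l → C l (π ⟨$⟩ʳ j)) (≡.sym (Perm.inverseʳ π))))
             (C≈ (π ⟨$⟩ˡ i) j))
           (reflexive (≡.cong (initial k) (Perm.inverseˡ π)))) ⟩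
    (corner k≤n d f *ᵛ initial k) (π ⟨$⟩ˡ i)
      ≈⟨ corner-*ᵛ-initial k≤n d f (π ⟨$⟩ˡ i) ⟩
    (f * fromℕ k + (d - f)) * v i ∎
    where
    open ≈-Reasoning
    v : Vector Carrier n
    v i = initial k (π ⟨$⟩ˡ i)

-- The bound as the larger root of t² = (d - f) t + m f

module QuadraticBound (ℝ : CompleteOrderedField) where
  open OrderedField ℝ

  module _ (d f m : Carrier) where
    bound : Carrier
    bound = (d - f + √ ((d - f) * (d - f) + fromℕ 4 * m * f)) / fromℕ 2

    private
      e = d - f
      Δ = e * e + fromℕ 4 * m * f

      double : ∀ t → fromℕ 2 * t ≈ t + t
      -- `fromℕ 2` unfolds to `1# + (1# + 0#)`, whereas `con (+ 2)` would denote `1# + 1#`; the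
      -- numeral is therefore spelled out.
      double = solve 1 (λ t → (con (+ 1) :+ (con (+ 1) :+ con (+ 0))) :* t := t :+ t) refl

      bound+bound : bound + bound ≈ e + √ Δ
      bound+bound = begin
        bound + bound                           ≈⟨ double bound ⟨
        fromℕ 2 * ((e + √ Δ) * fromℕ 2 ⁻¹)
          ≈⟨ solve 3 (λ t x w → t :* (x :* w) := t :* w :* x) refl (fromℕ 2) (e + √ Δ) (fromℕ 2 ⁻¹) ⟩
        fromℕ 2 * fromℕ 2 ⁻¹ * (e + √ Δ)
          ≈⟨ *-congʳ (⁻¹-inverseʳ (proj₂ (fromℕ-suc-positive 1) ∘ sym)) ⟩
        1# * (e + √ Δ)                          ≈⟨ *-identityˡ _ ⟩
        e + √ Δ                                 ∎
        where open ≈-Reasoning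

      √Δ≈ : √ Δ ≈ bound + bound - e
      √Δ≈ = trans (solve 2 (λ e s → s := e :+ s :- e) refl e (√ Δ)) (+-congʳ (sym bound+bound))

      halve-≤ : ∀ {s t} → s + s ≤ t + t → s ≤ t
      halve-≤ {s} {t} = *-cancelˡ-≤ (fromℕ-suc-positive 1) ∘ ≤-resp (sym (double s)) (sym (double t))

      -- Multiplying the quadratic by four avoids halves. The one identity serves the inequality,
      -- the root equation and uniqueness.
      complete-square : ∀ t → (t + t - e) * (t + t - e) ≈ Δ + fromℕ 4 * (t * t - (e * t + m * f))
      complete-square t = solve 4 (λ t e m f →
        let four = con (+ 1) :+ (con (+ 1) :+ (con (+ 1) :+ (con (+ 1) :+ con (+ 0)))) in
        (t :+ t :- e) :* (t :+ t :- e)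
          := e :* e :+ four :* m :* f :+ four :* (t :* t :- (e :* t :+ m :* f))) refl t e m f

    -- No sign of `m * f` is assumed: the hypothesis makes `Δ` dominate a square, which already
    -- shows that it is nonnegative.
    ≤-bound : ∀ {t} → t * t ≤ e * t + m * f → t ≤ bound
    ≤-bound {t} t²≤ = halve-≤ (begin
      t + t            ≈⟨ solve 2 (λ t e → t :+ t := e :+ (t :+ t :- e)) refl t e ⟩
      e + (t + t - e)  ≤⟨ +-mono-≤ ≤-refl (²-cancel-≤ (√-nonneg Δ)
                            (≤-respʳ-≈ (sym (√-square 0≤Δ)) square≤Δ)) ⟩
      e + √ Δ          ≈⟨ bound+bound ⟨
      bound + bound    ∎)
      where
      open ≤-Reasoning
      square≤Δ : (t + t - e) * (t + t - e) ≤ Δ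
      square≤Δ = begin
        (t + t - e) * (t + t - e)                    ≈⟨ complete-square t ⟩
        Δ + fromℕ 4 * (t * t - (e * t + m * f))
          ≤⟨ +-mono-≤ ≤-refl (*-monoˡ-≤ (fromℕ-nonneg 4) (+-monoˡ-≤ _ t²≤)) ⟩
        Δ + fromℕ 4 * (e * t + m * f - (e * t + m * f))
          ≈⟨ solve 3 (λ Δ c r → Δ :+ c :* (r :- r) := Δ) refl Δ (fromℕ 4) (e * t + m * f) ⟩
        Δ                                            ∎
      0≤Δ : 0# ≤ Δ
      0≤Δ = ≤-trans (0≤x² (t + t - e)) square≤Δ

    bound-root : 0# ≤ m * f → bound * bound ≈ e * bound + m * f
    bound-root 0≤mf = begin
      bound * bound  ≈⟨ solve 2 (λ x y → x := y :+ (x :- y)) refl _ _ ⟩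
      e * bound + m * f + (bound * bound - (e * bound + m * f))
        ≈⟨ +-congˡ (x*y≈0⇒y≈0 (proj₂ (fromℕ-suc-positive 3) ∘ sym) (begin
             fromℕ 4 * (bound * bound - (e * bound + m * f))
               ≈⟨ solve 2 (λ Δ r → r := Δ :+ r :- Δ) refl Δ _ ⟩
             Δ + fromℕ 4 * (bound * bound - (e * bound + m * f)) - Δ
               ≈⟨ +-congʳ (trans (sym (complete-square bound))
                    (trans (*-cong (sym √Δ≈) (sym √Δ≈)) (√-square 0≤Δ))) ⟩
             Δ - Δ
               ≈⟨ -‿inverseʳ Δ ⟩
             0# ∎)) ⟩
      e * bound + m * f + 0#  ≈⟨ +-identityʳ _ ⟩
      e * bound + m * f       ∎
      where
      open ≈-Reasoning
      0≤Δ : 0# ≤ Δ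
      0≤Δ = +-nonneg (0≤x² e) (≤-respʳ-≈ (sym (*-assoc _ _ _)) (*-nonneg (fromℕ-nonneg 4) 0≤mf))

    -- The condition `e ≤ t + t` selects the larger root: it makes 2t - e the nonnegative square
    -- root of `Δ`.
    bound-unique : ∀ {t} → e ≤ t + t → t * t ≈ e * t + m * f → bound ≈ t
    bound-unique {t} e≤2t t²≈ = *-cancelˡ-≈ (proj₂ (fromℕ-suc-positive 1) ∘ sym) (begin
      fromℕ 2 * bound  ≈⟨ double bound ⟩
      bound + bound    ≈⟨ bound+bound ⟩
      e + √ Δ          ≈⟨ +-congˡ (√-unique (x≤y⇒0≤y-x e≤2t) square≈Δ) ⟩
      e + (t + t - e)  ≈⟨ solve 2 (λ t e → e :+ (t :+ t :- e) := t :+ t) refl t e ⟩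
      t + t            ≈⟨ double t ⟨
      fromℕ 2 * t      ∎)
      where
      open ≈-Reasoning
      square≈Δ : (t + t - e) * (t + t - e) ≈ Δ
      square≈Δ = begin
        (t + t - e) * (t + t - e)                    ≈⟨ complete-square t ⟩
        Δ + fromℕ 4 * (t * t - (e * t + m * f))      ≈⟨ +-congˡ (*-congˡ (+-congʳ t²≈)) ⟩
        Δ + fromℕ 4 * (e * t + m * f - (e * t + m * f))
          ≈⟨ solve 3 (λ Δ c r → Δ :+ c :* (r :- r) := Δ) refl Δ (fromℕ 4) (e * t + m * f) ⟩
        Δ                                            ∎

-- The quadratic inequality for a subinvariant vector, and its equality case

module Subinvariant (ℝ : CompleteOrderedField) where
  open OrderedField ℝ
  open Matrices rawRing
  open BlockMatrices ℝ

  module _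
    {n : ℕ} {C : Matrix n n} (0≤C : ∀ i j → 0# ≤ C i j)
    {d f : Carrier} (diagonal≤d : ∀ i → C i i ≤ d) (offDiagonal≤f : ∀ i j → i ≢ j → C i j ≤ f)
    {ρ : Carrier} (0≤ρ : 0# ≤ ρ) {y : Vector Carrier n} (0≤y : ∀ i → 0# ≤ y i)
    (ρy≤Cy : ∀ i → ρ * y i ≤ (C *ᵛ y) i)
    (0≤f : 0# ≤ f) {i₀ : Fin n} (y≤M : ∀ j → y j ≤ y i₀) (0<M : 0# < y i₀)
    where

    M m : Carrier
    M = y i₀
    m = entrySum C

    entry≤fill : ∀ i j → C i j ≤ fill n d f i j
    entry≤fill i j = split (i Fin.≟ j)
      where
      split : Dec (i ≡ j) → C i j ≤ fill n d f i j
      split (yes ≡.refl) = ≤-respʳ-≈ (sym (fill-diagonal d f i)) (diagonal≤d i)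
      split (no i≢j)     = ≤-respʳ-≈ (sym (fill-offDiagonal d f i≢j)) (offDiagonal≤f i j i≢j)

    0≤ρy : ∀ i → 0# ≤ ρ * y i
    0≤ρy i = *-nonneg 0≤ρ (0≤y i)

    termwise : ∀ i j → C i j * (ρ * y j) ≤ fill n d f i j * (ρ * y j)
    termwise i j = *-monoʳ-≤ (0≤ρy j) (entry≤fill i j)

    entry*y≤entry*M : ∀ i j → C i j * y j ≤ C i j * M
    entry*y≤entry*M i j = *-monoˡ-≤ (0≤C i j) (y≤M j)

    C[ρy] : Vector Carrier n
    C[ρy] = C *ᵛ (ρ ·ᵛ y)

    ρρy≤C[ρy] : ∀ i → ρ * (ρ * y i) ≤ C[ρy] i
    ρρy≤C[ρy] i = begin
      ρ * (ρ * y i)                   ≤⟨ *-monoˡ-≤ 0≤ρ (ρy≤Cy i) ⟩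
      ρ * (C *ᵛ y) i                  ≈⟨ *-distribˡ-sum ρ (λ j → C i j * y j) ⟩
      (sum λ j → ρ * (C i j * y j))   ≈⟨ sum-cong-≋ (λ j → solve 3
                                           (λ r c y → r :* (c :* y) := c :* (r :* y))
                                           refl ρ (C i j) (y j)) ⟩
      C[ρy] i                         ∎
      where open ≤-Reasoning

    fill-ρy : ∀ i → (fill n d f *ᵛ (ρ ·ᵛ y)) i ≈ f * sum (ρ ·ᵛ y) + (d - f) * (ρ * y i)
    fill-ρy = fill-*ᵛ d f (ρ ·ᵛ y)

    Σρy≤ΣCy : sum (ρ ·ᵛ y) ≤ sum (C *ᵛ y)
    Σρy≤ΣCy = sum-mono-≤ ρy≤Cy

    row*M : ∀ i → (sum λ j → C i j * M) ≈ sum (C i) * M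
    row*M i = sym (*-distribʳ-sum M (C i))

    Cy≤row*M : ∀ i → (C *ᵛ y) i ≤ sum (C i) * M
    Cy≤row*M i = ≤-respʳ-≈ (row*M i) (sum-mono-≤ (entry*y≤entry*M i))

    Σrow*M : (sum λ i → sum (C i) * M) ≈ m * M
    Σrow*M = sym (*-distribʳ-sum M (sum ∘ C))

    ΣCy≤mM : sum (C *ᵛ y) ≤ m * M
    ΣCy≤mM = ≤-respʳ-≈ Σrow*M (sum-mono-≤ Cy≤row*M)

    C[ρy]≤ : ∀ i → C[ρy] i ≤ f * sum (ρ ·ᵛ y) + (d - f) * (ρ * y i)
    C[ρy]≤ i = ≤-respʳ-≈ (fill-ρy i) (sum-mono-≤ (termwise i))

    factor-M : f * (m * M) + (d - f) * (ρ * M) ≈ M * ((d - f) * ρ + m * f)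
    factor-M = solve 5 (λ f m M e ρ → f :* (m :* M) :+ e :* (ρ :* M) := M :* (e :* ρ :+ m :* f))
      refl f m M (d - f) ρ

    quadratic-≤ : ρ * ρ ≤ (d - f) * ρ + m * f
    quadratic-≤ = *-cancelˡ-≤ 0<M (begin
      M * (ρ * ρ)                                ≈⟨ solve 2 (λ M ρ → M :* (ρ :* ρ) := ρ :* (ρ :* M)) refl M ρ ⟩
      ρ * (ρ * M)                                ≤⟨ ρρy≤C[ρy] i₀ ⟩
      C[ρy] i₀                                   ≤⟨ C[ρy]≤ i₀ ⟩
      -- Only the sum is enlarged, which needs `0≤f`; the term with d - f, of unknown sign, is
      -- carried along unchanged.
      f * sum (ρ ·ᵛ y) + (d - f) * (ρ * M)       ≤⟨ +-monoˡ-≤ _ (*-monoˡ-≤ 0≤f (≤-trans Σρy≤ΣCy ΣCy≤mM)) ⟩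
      f * (m * M) + (d - f) * (ρ * M)            ≈⟨ factor-M ⟩
      M * ((d - f) * ρ + m * f)                  ∎)
      where open ≤-Reasoning

    module Tight (0≉f : 0# ≉ f) (0≉ρ : 0# ≉ ρ) (ρ²≈ : ρ * ρ ≈ (d - f) * ρ + m * f) where

      ρρM≈ : ρ * (ρ * M) ≈ f * (m * M) + (d - f) * (ρ * M)
      ρρM≈ = trans (solve 2 (λ M ρ → ρ :* (ρ :* M) := M :* (ρ :* ρ)) refl M ρ)
        (trans (*-congˡ ρ²≈) (sym factor-M))

      -- The equation for ρ makes the two ends of the chain at `i₀` coincide. Cancelling the common
      -- term and f > 0 reverses the estimate of the sum, and so leaves no slack in any row.
      mM≤Σρy : m * M ≤ sum (ρ ·ᵛ y)
      mM≤Σρy = *-cancelˡ-≤ (0≤f , 0≉f) (+-cancelʳ-≤ ((d - f) * (ρ * M))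
        (≤-respˡ-≈ ρρM≈ (≤-trans (ρρy≤C[ρy] i₀) (C[ρy]≤ i₀))))

      ρy≈Cy : ∀ i → ρ * y i ≈ (C *ᵛ y) i
      ρy≈Cy = sum-mono-≤-tight ρy≤Cy (≤-trans ΣCy≤mM mM≤Σρy)

      Cy≈row*M : ∀ i → (C *ᵛ y) i ≈ sum (C i) * M
      Cy≈row*M = sum-mono-≤-tight Cy≤row*M
        (≤-respˡ-≈ (sym Σrow*M) (≤-trans mM≤Σρy Σρy≤ΣCy))

      -- Every row is tight, not only row `i₀`, so C i j (M - y j) = 0 holds for all `i`.
      column-zero : ∀ i {j} → y j ≉ M → C i j ≈ 0#
      column-zero i {j} yⱼ≉M = x*y≈0⇒y≈0 M-yⱼ≉0 (begin
        (M - y j) * C i j       ≈⟨ solve 3 (λ M y c → (M :- y) :* c := c :* M :- c :* y)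
                                     refl M (y j) (C i j) ⟩
        C i j * M - C i j * y j ≈⟨ +-congˡ (-‿cong (tight i j)) ⟩
        C i j * M - C i j * M   ≈⟨ -‿inverseʳ _ ⟩
        0#                      ∎)
        where
        open ≈-Reasoning
        tight : ∀ i j → C i j * y j ≈ C i j * M
        tight i = sum-mono-≤-tight (entry*y≤entry*M i)
          (≤-reflexive (trans (row*M i) (sym (Cy≈row*M i))))
        M-yⱼ≉0 : M - y j ≉ 0#
        M-yⱼ≉0 M-y≈0 = yⱼ≉M (trans (solve 2 (λ y M → y := M :- (M :- y)) refl (y j) M)
          (trans (+-congˡ (-‿cong M-y≈0)) (solve 1 (λ M → M :- con (+ 0) := M) refl M)))

      -- The chain of estimates is tight at every index where `y` attains `M`. Tightness then passes
      -- to the single terms, from which the nonzero factors ρ and `y j` cancel.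
      entry≈fill : ∀ {i j} → y i ≈ M → y j ≉ 0# → C i j ≈ fill n d f i j
      entry≈fill {i} {j} yᵢ≈M yⱼ≉0 = *-cancelˡ-≈ (0≉ρ ∘ sym) (*-cancelˡ-≈ yⱼ≉0
        (trans (shuffle (C i j)) (trans (tight j) (sym (shuffle (fill n d f i j))))))
        where
        shuffle : ∀ c → y j * (ρ * c) ≈ c * (ρ * y j)
        shuffle c = solve 3 (λ y ρ c → y :* (ρ :* c) := c :* (ρ :* y)) refl (y j) ρ c
        tight : ∀ j → C i j * (ρ * y j) ≈ fill n d f i j * (ρ * y j)
        tight = sum-mono-≤-tight (termwise i) (begin
          (fill n d f *ᵛ (ρ ·ᵛ y)) i                 ≈⟨ fill-ρy i ⟩
          f * sum (ρ ·ᵛ y) + (d - f) * (ρ * y i)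
            ≤⟨ +-monoˡ-≤ _ (*-monoˡ-≤ 0≤f (≤-trans Σρy≤ΣCy ΣCy≤mM)) ⟩
          f * (m * M) + (d - f) * (ρ * y i)          ≈⟨ +-congˡ (*-congˡ (*-congˡ yᵢ≈M)) ⟩
          f * (m * M) + (d - f) * (ρ * M)            ≈⟨ ρρM≈ ⟨
          ρ * (ρ * M)                                ≈⟨ *-congˡ (*-congˡ yᵢ≈M) ⟨
          ρ * (ρ * y i)                              ≤⟨ ρρy≤C[ρy] i ⟩
          C[ρy] i                                    ∎)
          where open ≤-Reasoning

      M≉0 : M ≉ 0#
      M≉0 = proj₂ 0<M ∘ sym

      -- If 0 < yᵢ < M, then the entry (i₀, i) would be f > 0, yet column i vanishes.
      y≈0 : ∀ {i} → y i ≉ M → y i ≈ 0#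
      y≈0 {i} yᵢ≉M with y i ≈? 0#
      ... | yes yᵢ≈0 = yᵢ≈0
      ... | no  yᵢ≉0 = contradiction
        (trans (sym (column-zero i₀ yᵢ≉M))
          (trans (entry≈fill refl yᵢ≉0) (fill-offDiagonal d f {i₀} {i} λ { ≡.refl → yᵢ≉M refl })))
        0≉f

      -- A column with `y j ≈ M` remains: there (Cy)ᵢ = ρ yᵢ = 0 is a sum of nonnegative terms, so C
      -- i j M vanishes.
      row-zero : ∀ {i} j → y i ≉ M → C i j ≈ 0#
      row-zero {i} j yᵢ≉M with y j ≈? M
      ... | no  yⱼ≉M = column-zero i yⱼ≉M
      ... | yes yⱼ≈M = x*y≈0⇒y≈0 M≉0 (trans (*-congʳ (sym yⱼ≈M)) (trans (*-comm _ _)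
        (sum-nonneg-≈0 (λ j → *-nonneg (0≤C i j) (0≤y j)) Cy≈0 j)))
        where
        Cy≈0 : (C *ᵛ y) i ≈ 0#
        Cy≈0 = trans (sym (ρy≈Cy i)) (trans (*-congˡ (y≈0 yᵢ≉M)) (zeroʳ ρ))

      structure : Σ[ π ∈ Permutation′ n ] Σ[ k ∈ ℕ ] Σ[ k≤n ∈ k ℕ.≤ n ]
        m ≈ fromℕ k * (fromℕ k - 1#) * f + fromℕ k * d ×
        (∀ i j → C (π ⟨$⟩ʳ i) (π ⟨$⟩ʳ j) ≈ corner k≤n d f i j)
      structure with partition (λ i → y i ≈? M)
      ... | π , k , k≤n , below , above = π , k , k≤n , m≈ , C≈corner
        where
        C≈corner : ∀ i j → C (π ⟨$⟩ʳ i) (π ⟨$⟩ʳ j) ≈ corner k≤n d f i j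
        C≈corner i j with toℕ i ℕ.<? k | toℕ j ℕ.<? k
        ... | no i≮k | _ =
          trans (row-zero _ (above i i≥k)) (sym (corner-rowOutside k≤n d f i≥k j))
          where i≥k = ℕ.≮⇒≥ i≮k
        ... | yes _ | no j≮k =
          trans (column-zero _ (above j j≥k)) (sym (corner-columnOutside k≤n d f i j≥k))
          where j≥k = ℕ.≮⇒≥ j≮k
        ... | yes i<k | yes j<k = begin
          C (π ⟨$⟩ʳ i) (π ⟨$⟩ʳ j)
            ≈⟨ entry≈fill (below i i<k) (M≉0 ∘ trans (sym (below j j<k))) ⟩
          fill n d f (π ⟨$⟩ʳ i) (π ⟨$⟩ʳ j)
            ≈⟨ fill-reindex d f (mk⇔ (Injection.injective (↔⇒↣ π)) (≡.cong (π ⟨$⟩ʳ_))) ⟩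
          fill n d f i j
            ≈⟨ corner-inside k≤n d f i<k j<k ⟨
          corner k≤n d f i j ∎
          where open ≈-Reasoning

        μ : Carrier
        μ = f * fromℕ k + (d - f)

        v : Vector Carrier n
        v i = initial k (π ⟨$⟩ˡ i)

        v≡1 : ∀ {j} → y j ≈ M → v j ≡ 1#
        v≡1 {j} yⱼ≈M with toℕ (π ⟨$⟩ˡ j) ℕ.<? k
        ... | yes j<k = initial-< j<k
        ... | no  j≮k = contradiction
          (≡.subst (λ l → y l ≈ M) (≡.sym (Perm.inverseʳ π)) yⱼ≈M) (above _ (ℕ.≮⇒≥ j≮k))

        -- To `C`, the vector `y` looks like `M` times the indicator `v`: wherever they could
        -- differ, the column of `C` is zero.
        C*y≈M*Cv : ∀ i j → C i j * y j ≈ M * (C i j * v j)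
        C*y≈M*Cv i j with y j ≈? M
        ... | yes yⱼ≈M = begin
          C i j * y j         ≈⟨ *-congˡ yⱼ≈M ⟩
          C i j * M           ≈⟨ solve 2 (λ c M → c :* M := M :* (c :* con (+ 1))) refl (C i j) M ⟩
          M * (C i j * 1#)    ≈⟨ *-congˡ (*-congˡ (reflexive (v≡1 yⱼ≈M))) ⟨
          M * (C i j * v j)   ∎
          where open ≈-Reasoning
        ... | no  yⱼ≉M = begin
          C i j * y j         ≈⟨ *-congʳ (column-zero i yⱼ≉M) ⟩
          0# * y j            ≈⟨ solve 3 (λ y v M → con (+ 0) :* y := M :* (con (+ 0) :* v))
                                   refl (y j) (v j) M ⟩
          M * (0# * v j)      ≈⟨ *-congˡ (*-congʳ (column-zero i yⱼ≉M)) ⟨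
          M * (C i j * v j)   ∎
          where open ≈-Reasoning

        ρ≈μ : ρ ≈ μ
        ρ≈μ = *-cancelˡ-≈ M≉0 (begin
          M * ρ                             ≈⟨ *-comm M ρ ⟩
          ρ * M                             ≈⟨ ρy≈Cy i₀ ⟩
          (C *ᵛ y) i₀                       ≈⟨ sum-cong-≋ (C*y≈M*Cv i₀) ⟩
          (sum λ j → M * (C i₀ j * v j))    ≈⟨ *-distribˡ-sum M (λ j → C i₀ j * v j) ⟨
          M * (C *ᵛ v) i₀                   ≈⟨ *-congˡ (corner-eigenvector π k≤n d f C≈corner i₀) ⟩
          M * (μ * v i₀)                    ≈⟨ *-congˡ (*-congˡ (reflexive (v≡1 refl))) ⟩
          M * (μ * 1#)                      ≈⟨ *-congˡ (*-identityʳ μ) ⟩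
          M * μ                             ∎)
          where open ≈-Reasoning

        m≈ : m ≈ fromℕ k * (fromℕ k - 1#) * f + fromℕ k * d
        -- Rather than by adding up the entries of the block, `m` is found from f m = ρ² - (d - f)
        -- ρ, now that ρ is known in terms of `k`.
        m≈ = *-cancelˡ-≈ (0≉f ∘ sym) (begin
          f * m                             ≈⟨ solve 4 (λ f m e ρ → f :* m := e :* ρ :+ m :* f :- e :* ρ)
                                                 refl f m (d - f) ρ ⟩
          (d - f) * ρ + m * f - (d - f) * ρ ≈⟨ +-congʳ ρ²≈ ⟨
          ρ * ρ - (d - f) * ρ               ≈⟨ +-cong (*-cong ρ≈μ ρ≈μ) (-‿cong (*-congˡ ρ≈μ)) ⟩
          μ * μ - (d - f) * μ
            ≈⟨ solve 3 (λ d f k → let e = d :- f; μ = f :* k :+ e in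
                 μ :* μ :- e :* μ := f :* (k :* (k :- con (+ 1)) :* f :+ k :* d))
                 refl d f (fromℕ k) ⟩
          f * (fromℕ k * (fromℕ k - 1#) * f + fromℕ k * d) ∎)
          where open ≈-Reasoning

-- The upper bound in every dimension, and its attainment

module Bound (ℝ : CompleteOrderedField) where
  open OrderedField ℝ
  open Matrices rawRing
  open SpectralRadius ℝ
  open QuadraticBound ℝ
  open BlockMatrices ℝ
  open Complex ℝ
  open Modulus ℝ
  open Eigenvalues ℝ

  -- A vector that is not zero also rules out n = 0, so no separate assumption on the dimension is
  -- needed.
  positive-maximum : ∀ {n} {y : Vector Carrier n} → (∀ i → 0# ≤ y i) → ¬ (∀ i → y i ≈ 0#) →
                     ∃ λ i → (∀ j → y j ≤ y i) × 0# < y i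
  positive-maximum {ℕ.zero}  0≤y y≉0 = contradiction (λ ()) y≉0
  positive-maximum {ℕ.suc n} {y} 0≤y y≉0 with maximum y
  ... | i , y≤yᵢ = i , y≤yᵢ , 0≤y i , λ 0≈yᵢ →
    y≉0 λ j → antisym (≤-respʳ-≈ (sym 0≈yᵢ) (y≤yᵢ j)) (0≤y j)

  subinvariant-≤-bound : ∀ {n} {C : Matrix n n} → (∀ i j → 0# ≤ C i j) →
    ∀ {d f} → (∀ i → C i i ≤ d) → (∀ i j → i ≢ j → C i j ≤ f) →
    ∀ {ρ} → 0# ≤ ρ → {y : Vector Carrier n} → (∀ i → 0# ≤ y i) →
    (∀ i → ρ * y i ≤ (C *ᵛ y) i) → ∀ {i} → (∀ j → y j ≤ y i) → 0# < y i →
    ρ ≤ bound d f (entrySum C)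
  -- For n = 1 the number f is arbitrary, possibly negative.
  subinvariant-≤-bound {1} {C} 0≤C {d} {f} C≤d C≤f {ρ} 0≤ρ {y} 0≤y ρy≤Cy {zero} _ 0<y =
    ≤-trans
      (*-cancelˡ-≤ 0<y (≤-resp (*-comm ρ (y zero))
        (trans (+-identityʳ _) (*-comm c (y zero))) (ρy≤Cy zero)))
      (≤-bound d f (entrySum C) (begin
        -- For n = 1 the entry sum is `c`, so the two terms in `f` cancel and only c² ≤ dc has to be
        -- shown.
        c * c                                ≤⟨ *-monoʳ-≤ (0≤C zero zero) (C≤d zero) ⟩
        d * c                                ≈⟨ solve 3 (λ d f c → d :* c
                                                  := (d :- f) :* c :+ (c :+ con (+ 0) :+ con (+ 0)) :* f)
                                                  refl d f c ⟩
        (d - f) * c + entrySum C * f         ∎))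
    where
    open ≤-Reasoning
    c = C zero zero
  subinvariant-≤-bound {ℕ.suc (ℕ.suc n)} {C} 0≤C {d} {f} C≤d C≤f 0≤ρ 0≤y ρy≤Cy y≤M 0<M =
    ≤-bound d f (entrySum C)
      (Subinvariant.quadratic-≤ ℝ 0≤C C≤d C≤f 0≤ρ 0≤y ρy≤Cy 0≤f y≤M 0<M)
    where
    0≤f : 0# ≤ f
    -- Two distinct indices supply an off-diagonal entry, which lies between 0 and `f`.
    0≤f = ≤-trans (0≤C zero (suc zero)) (C≤f zero (suc zero) λ ())

  -- The permuted indicator has eigenvalue μ = (k - 1) f + d for a block of size k. The formula for
  -- the entry sum makes μ a root of the quadratic, and the larger one, so μ is the bound. The block
  -- size is a successor because an empty block would give the zero vector.
  corner-bound≤spectralRadius : ∀ {n} {C : Matrix n n} → (∀ i j → 0# ≤ C i j) →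
    ∀ {d f} → (∀ i → C i i ≤ d) → 0# ≤ f → ∀ {ρ} → IsSpectralRadius C ρ →
    ∀ (π : Permutation′ n) {k} (k≤n : ℕ.suc k ℕ.≤ n) →
    entrySum C ≈ fromℕ (ℕ.suc k) * (fromℕ (ℕ.suc k) - 1#) * f + fromℕ (ℕ.suc k) * d →
    (∀ i j → C (π ⟨$⟩ʳ i) (π ⟨$⟩ʳ j) ≈ corner k≤n d f i j) →
    bound d f (entrySum C) ≤ ρ
  corner-bound≤spectralRadius {n} {C} 0≤C {d} {f} C≤d 0≤f {ρ} (_ , ∣λ∣≤ρ) π {k} k<n m≈ C≈corner =
    begin
      bound d f (entrySum C)  ≈⟨ bound-unique d f (entrySum C) d-f≤μ+μ μ²≈ ⟩
      μ                       ≈⟨ modulus-fromReal 0≤μ ⟨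
      modulus (fromReal μ)    ≤⟨ ∣λ∣≤ρ (fromReal μ)
                                   (real-eigenvalue v≉0 (corner-eigenvector π k<n d f C≈corner)) ⟩
      ρ                       ∎
    where
    open ≤-Reasoning
    κ μ : Carrier
    κ = fromℕ (ℕ.suc k)
    μ = f * κ + (d - f)

    i₀ : Fin n
    i₀ = fromℕ< (ℕ.≤-<-trans z≤n k<n)

    v : Vector Carrier n
    v i = initial (ℕ.suc k) (π ⟨$⟩ˡ i)

    v≉0 : ¬ (v ≈ᵛ 0ᵛ)
    v≉0 v≈0 = 1≉0 (trans (sym (reflexive (≡.trans
      (≡.cong (initial (ℕ.suc k)) (Perm.inverseˡ π))
      (initial-< {ℕ.suc k} {i = i₀} (≡.subst (ℕ._< ℕ.suc k) (≡.sym (Fin.toℕ-fromℕ< _)) (s≤s z≤n))))))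
      (v≈0 (π ⟨$⟩ʳ i₀)))

    0≤μ : 0# ≤ μ
    -- Since `κ` is `1# + fromℕ k`, μ equals f k + d; here d is nonnegative because it exceeds a
    -- diagonal entry.
    0≤μ = ≤-respʳ-≈
      (solve 3 (λ f k d → f :* k :+ d := f :* (con (+ 1) :+ k) :+ (d :- f)) refl f (fromℕ k) d)
      (+-nonneg (*-nonneg 0≤f (fromℕ-nonneg k)) (≤-trans (0≤C i₀ i₀) (C≤d i₀)))

    d-f≤μ+μ : d - f ≤ μ + μ
    d-f≤μ+μ = 0≤y-x⇒x≤y (≤-respʳ-≈
      (solve 3 (λ f κ e → let μ = f :* κ :+ e in f :* κ :+ μ := μ :+ μ :- e) refl f κ (d - f))
      (+-nonneg (*-nonneg 0≤f (fromℕ-nonneg (ℕ.suc k))) 0≤μ))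

    μ²≈ : μ * μ ≈ (d - f) * μ + entrySum C * f
    μ²≈ = trans
      (solve 3 (λ d f κ → let e = d :- f; μ = f :* κ :+ e in
        μ :* μ := e :* μ :+ (κ :* (κ :- con (+ 1)) :* f :+ κ :* d) :* f) refl d f κ)
      (+-congˡ (*-congʳ (sym m≈)))

-- Assembly of the inequality and the characterisation of equality

theorem7p2 :
  (ℝ : CompleteOrderedField) →
  let open CompleteOrderedField ℝ
      open SquareRoot ℝ using (√)
      open Matrices rawRing
      open SpectralRadius ℝ using (IsSpectralRadius)
  in
  ∀ {n : ℕ} (C : Matrix n n) → (∀ i j → 0# ≤ C i j) →
  ∀ (d f : Carrier) → (∀ i → C i i ≤ d) → (∀ i j → i ≢ j → C i j ≤ f) →
  ∀ (ρ : Carrier) → IsSpectralRadius C ρ →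
  let m = entrySum C
      bound = (d - f + √ ((d - f) * (d - f) + fromℕ 4 * m * f)) / fromℕ 2
  in
  ρ ≤ bound ×
  (0# < m * f →
    ρ ≈ bound ⇔
    (Σ[ π ∈ Permutation′ n ] Σ[ k ∈ ℕ ] Σ[ k≤n ∈ k ℕ.≤ n ]
      let P = permutationMatrix π
      in
      m ≈ fromℕ k * (fromℕ k - 1#) * f + fromℕ k * d ×
      P *ᴹ C *ᴹ transpose P ≈ᴹ
        castᴹ (m+[n∸m]≡n k≤n)
          (blocks (f ·ᴹ J k +ᴹ (d - f) ·ᴹ I k) (O k (n ∸ k))
                  (O (n ∸ k) k)                (O (n ∸ k) (n ∸ k)))))
theorem7p2 ℝ {n} C 0≤C d f C≤d C≤f ρ isρ@((μ , (x , x≉0 , Cx≈μx) , ∣μ∣≈ρ) , _) =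
  ρ≤bound , λ (0≤mf , 0≉mf) →
    let
      f≉0 : f ≉ 0#
      f≉0 f≈0 = 0≉mf (sym (trans (*-congˡ f≈0) (zeroʳ m)))

      0≤f : 0# ≤ f
      0≤f = nonneg-factor 0≤mf 0≉mf

      necessity : ρ ≈ bound d f m → _
      necessity ρ≈bound =
        let
          ρ²≈ : ρ * ρ ≈ (d - f) * ρ + m * f
          ρ²≈ = trans (*-cong ρ≈bound ρ≈bound)
            (trans (bound-root d f m 0≤mf) (+-congʳ (*-congˡ (sym ρ≈bound))))

          0≉ρ : 0# ≉ ρ
          -- At ρ = 0 the quadratic equation would read 0 = m f.
          0≉ρ 0≈ρ = 0≉mf (sym (trans (solve 2 (λ e r → r := e :* con (+ 0) :+ r) refl (d - f) (m * f))
            (trans (+-congʳ (*-congˡ 0≈ρ)) (trans (sym ρ²≈) (trans (*-congʳ (sym 0≈ρ)) (zeroˡ ρ))))))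

          π , k , k≤n , m≈ , C≈corner = Subinvariant.Tight.structure ℝ 0≤C C≤d C≤f 0≤ρ 0≤y ρy≤Cy
            0≤f y≤M 0<M (f≉0 ∘ sym) 0≉ρ ρ²≈
        in π , k , k≤n , m≈ , λ i j → trans (permutation-conjugate π C i j) (C≈corner i j)
    in mk⇔ necessity λ
      -- With k = 0 the formula gives m = 0, contrary to mf > 0.
      { (π , ℕ.zero , k≤n , m≈ , _) → contradiction
          (sym (trans (*-congʳ m≈) (solve 2 (λ d f →
            (con (+ 0) :* (con (+ 0) :- con (+ 1)) :* f :+ con (+ 0) :* d) :* f := con (+ 0)) refl d f)))
          0≉mf
      ; (π , ℕ.suc k , k≤n , m≈ , PCPᵀ≈) → antisym ρ≤bound
          (corner-bound≤spectralRadius 0≤C C≤d 0≤f isρ π k≤n m≈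
            λ i j → trans (sym (permutation-conjugate π C i j)) (PCPᵀ≈ i j))
      }
  where
  open OrderedField ℝ
  open Complex ℝ
  open Modulus ℝ
  open Eigenvalues ℝ
  open Matrices rawRing
  open BlockMatrices ℝ
  open QuadraticBound ℝ
  open Bound ℝ

  m : Carrier
  m = entrySum C

  y : Vector Carrier n
  y = modulus ∘ x

  0≤y : ∀ i → 0# ≤ y i
  0≤y = modulus-nonneg ∘ x

  0≤ρ : 0# ≤ ρ
  0≤ρ = ≤-respʳ-≈ ∣μ∣≈ρ (modulus-nonneg μ)

  ρy≤Cy : ∀ i → ρ * y i ≤ (C *ᵛ y) i
  ρy≤Cy i = ≤-respˡ-≈ (*-congʳ ∣μ∣≈ρ) (modulus-subinvariant 0≤C μ x Cx≈μx i)

  yMax : ∃ λ i → (∀ j → y j ≤ y i) × 0# < y i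
  yMax = positive-maximum 0≤y (λ y≈0 → x≉0 (modulus≈0⇒≈0 ∘ y≈0))

  y≤M = proj₁ (proj₂ yMax)
  0<M = proj₂ (proj₂ yMax)

  ρ≤bound : ρ ≤ bound d f m
  ρ≤bound = subinvariant-≤-bound 0≤C C≤d C≤f 0≤ρ 0≤y ρy≤Cy y≤M 0<M

  -- As a sum of entries `m` is nonnegative, so `f ≤ 0` would leave `m * f` no value but zero. This
  -- fixes the sign of `f` in every dimension, including n = 1.
  nonneg-factor : 0# ≤ m * f → 0# ≉ m * f → 0# ≤ f
  nonneg-factor 0≤mf 0≉mf with total 0# f
  ... | inj₁ 0≤f = 0≤f
  ... | inj₂ f≤0 = contradiction (antisym 0≤mf
    (≤-respʳ-≈ (zeroʳ m) (*-monoˡ-≤ (sum-nonneg (sum-nonneg ∘ 0≤C)) f≤0))) 0≉mf
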